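{- Let $q$ be an odd prime power and let $d\ge 2$ be even. For every $\varepsilon>0$ there exists $c>0$ such that the following holds: if $\mathcal{P}\subseteq \mathbb{F}_q^d$ satisfies $|\mathcal{P}|\ge (1+\varepsilon)q^{d/2}$, then the number of distinct spreads determined by $\mathcal{P}$ is at least $cq$.
   Context: For $\mathbf{u},\mathbf{v}\in\mathbb{F}_q^d$, $\mathbf{u}\cdot\mathbf{v}=\sum_{i=1}^d u_iv_i$ and $\|\mathbf{x}\|=\mathbf{x}\cdot\mathbf{x}$. For points $\mathbf{a},\mathbf{b},\mathbf{c}\in\mathbb{F}_q^d$, the spread $S(\mathbf{b},\mathbf{a},\mathbf{c})$ between the vectors $\mathbf{b}-\mathbf{a}$ and $\mathbf{c}-\mathbf{a}$ is $$S(\mathbf{b},\mathbf{a},\mathbf{c})=1-\frac{((\mathbf{b}-\mathbf{a})\cdot(\mathbf{c}-\mathbf{a}))^2}{\|\mathbf{b}-\mathbf{a}\|\,\|\mathbf{c}-\mathbf{a}\|},$$ which is undefined if either factor in the denominator is $0$. The spreads determined by $\mathcal{P}$ are the values $S(\mathbf{b},\mathbf{a},\mathbf{c})\in\mathbb{F}_q$ over all $\mathbf{a},\mathbf{b},\mathbf{c}\in\mathcal{P}$ for which the spread is defined. The paper assumes throughout that $q$ is a large odd prime power. -}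

module Defs where

open import Level using (Level; _⊔_; suc)
open import Algebra.Bundles using (CommutativeRing)
open import Data.Nat as ℕ using (ℕ)
open import Data.Vec as Vec using (Vec)
open import Data.List as List using (List; []; _∷_; length; deduplicate; concatMap)
open import Data.List.Relation.Unary.Any using (Any)
open import Data.List.Relation.Unary.AllPairs using (AllPairs)
open import Relation.Binary.Definitions using (Decidable)
open import Relation.Binary.PropositionalEquality using (_≡_)
open import Relation.Nullary using (¬_; yes; no)
open import Data.Vec.Relation.Binary.Pointwise.Inductive as PW using (Pointwise)

-- A finite field with exactly q elements (counted up to its setoid equality _≈_):
-- a commutative ring with 1 ≉ 0, decidable equality, multiplicative inverses
-- of nonzero elements, and a duplicate-free exhaustive enumeration of length q.
-- (The inverse is a total function; its value at 0 is irrelevant and never used.)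
record FiniteField (c ℓ : Level) (q : ℕ) : Set (suc (c ⊔ ℓ)) where
  field
    commRing : CommutativeRing c ℓ
  open CommutativeRing commRing public
  field
    _≟_        : Decidable _≈_
    1≉0        : ¬ (1# ≈ 0#)
    _⁻¹        : Carrier → Carrier
    ⁻¹-inverse : ∀ x → ¬ (x ≈ 0#) → (x * (x ⁻¹)) ≈ 1#
    elements   : List Carrier
    elements-complete : ∀ x → Any (x ≈_) elements
    elements-distinct : AllPairs (λ x y → ¬ (x ≈ y)) elements
    elements-length   : length elements ≡ q

module Geometry {c ℓ : Level} {q : ℕ} (F : FiniteField c ℓ q) where
  open FiniteField F

  Point : ℕ → Set c
  Point d = Vec Carrier d

  _-ᵥ_ : ∀ {d} → Point d → Point d → Point d
  u -ᵥ v = Vec.zipWith (λ x y → x - y) u v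

  _·_ : ∀ {d} → Point d → Point d → Carrier
  u · v = Vec.foldr _ _+_ 0# (Vec.zipWith _*_ u v)

  ‖_‖ : ∀ {d} → Point d → Carrier
  ‖ x ‖ = x · x

  _≋_ : ∀ {d} → Point d → Point d → Set (c ⊔ ℓ)
  _≋_ = Pointwise _≈_

  _≋?_ : ∀ {d} → Decidable (_≋_ {d})
  _≋?_ = PW.decidable _≟_

  -- spread S(b,a,c) given that it is defined (denominator factors nonzero)
  spreadValue : ∀ {d} → Point d → Point d → Point d → Carrier
  spreadValue b a c' =
    1# - ((((b -ᵥ a) · (c' -ᵥ a)) * ((b -ᵥ a) · (c' -ᵥ a)))
          * ((‖ b -ᵥ a ‖ * ‖ c' -ᵥ a ‖) ⁻¹))

  spreadList : ∀ {d} → List (Point d) → List Carrier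
  spreadList P =
    concatMap (λ a → concatMap (λ b → concatMap (λ c' → entry a b c') P) P) P
    where
      entry : _ → _ → _ → List Carrier
      entry a b c' with ‖ b -ᵥ a ‖ ≟ 0# | ‖ c' -ᵥ a ‖ ≟ 0#
      ... | no _ | no _ = spreadValue b a c' ∷ []
      ... | _    | _    = []

  card : ∀ {d} → List (Point d) → ℕ
  card P = length (deduplicate _≋?_ P)

  numSpreads : ∀ {d} → List (Point d) → ℕ
  numSpreads P = length (deduplicate _≟_ (spreadList P))

-- Write d = 2k and Q = q ^ k, and shrink P to between (1 + 1/m) Q and 2Q points, where 1/m ≤ ε.
-- The engine is a variance estimate.  Only a proportion 1/q of all vectors x satisfies x · y = x · z for
-- given y ≠ z, so the energy #{(y, z) ∈ Y² : x · y = x · z} exceeds its minimum |Y|²/q by at most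
-- |Y| q^d in total over x (after clearing the factor 1/q); moreover, the energy depends only on
-- the line through 0 and x.
--
-- If D is a set of at least Q / K pairwise nonparallel anisotropic vectors, rescale many of them to
-- a sphere Y.  Some w ∈ D then has energy at most (1 + K²) |Y|²/q, so by Cauchy-Schwarz the products
-- w · y take at least q / (1 + K²) values, and a spread determines the product up to sign.
--
-- It remains to find a point of P from which P is seen in at least Q / K anisotropic directions.
-- Suppose there is none.  On an anisotropic line, only boundedly many points can have isotropic
-- differences with a positive proportion of P, because each point of P has an isotropic difference
-- with at most two points of the line.  Hence either all points of P have isotropic differences with
-- nearly all of P, which contradicts the variance estimate (with Y = X = the differences from one
-- point), or almost all points have few of them, and therefore see P in few directions altogether.
-- In that case some linear map to a space of Q points kills few of the directions, so it is nearly
-- injective on P, which contradicts |P| ≥ (1 + 1/m) Q.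
module Submission where

open import Defs
open import Level using (Level)
open import Algebra.Bundles using (CommutativeRing; RawRing)
open import Data.Nat using (ℕ)

-- Finite sums, double counting and Cauchy-Schwarz

module Counting where
  open import Data.Nat using (_+_; _*_; _∸_; _≤_; _<_; z≤n; s≤s)
  open import Data.Nat.Properties hiding (_≟_)
  open import Data.Nat.Divisibility using (_∣_; divides; ∣m∣n⇒∣m+n; _∣0)
  open import Data.Nat.Tactic.RingSolver using (solve-∀)
  open import Data.List using (List; []; _∷_; _++_; length; map; filter; concatMap; deduplicate; take)
  open import Data.List.Membership.Propositional using (_∈_; find; lose)
  open import Data.List.Relation.Unary.All as All using ([]; _∷_)
  import Data.List.Relation.Unary.All.Properties as All
  open import Data.List.Relation.Unary.Any as Any using (Any; here; there)
  open import Data.List.Relation.Unary.AllPairs using (AllPairs; []; _∷_)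
  import Data.List.Relation.Unary.AllPairs.Properties as AllPairs
  open import Data.Product using (∃; _×_)
  open import Data.Sum using (inj₁; inj₂)
  open import Data.Empty using (⊥; ⊥-elim)
  open import Function using (_∘_)
  open import Relation.Nullary using (¬_; Dec; yes; no)
  open import Relation.Nullary.Decidable using (¬?)
  open import Relation.Unary using (Decidable)
  open import Relation.Binary using (Rel) renaming (Decidable to Decidable₂)
  open import Relation.Binary.PropositionalEquality using (_≡_; refl; sym; trans; cong; cong₂; subst)

  private
    variable
      a b p r : Level
      A : Set a
      B : Set b
      P Q : Set p

  𝟙 : Dec P → ℕ
  𝟙 (yes _) = 1
  𝟙 (no _) = 0

  𝟙-yes : (d : Dec P) → P → 𝟙 d ≡ 1
  𝟙-yes (yes _) _ = refl
  𝟙-yes (no ¬p) p = ⊥-elim (¬p p)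

  𝟙-no : (d : Dec P) → ¬ P → 𝟙 d ≡ 0
  𝟙-no (yes p) ¬p = ⊥-elim (¬p p)
  𝟙-no (no _) _ = refl

  𝟙≤ : (d : Dec P) {n : ℕ} → (P → 1 ≤ n) → 𝟙 d ≤ n
  𝟙≤ (yes p) h = h p
  𝟙≤ (no _) _ = z≤n

  𝟙*≤ : (d : Dec P) {m n : ℕ} → (P → m ≤ n) → 𝟙 d * m ≤ n
  𝟙*≤ (yes p) {m} h = ≤-trans (≤-reflexive (+-identityʳ m)) (h p)
  𝟙*≤ (no _) _ = z≤n

  1≤𝟙 : (d : Dec P) → P → 1 ≤ 𝟙 d
  1≤𝟙 d p = ≤-reflexive (sym (𝟙-yes d p))

  𝟙-mono : (d : Dec P) (e : Dec Q) → (P → Q) → 𝟙 d ≤ 𝟙 e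
  𝟙-mono d e f = 𝟙≤ d (1≤𝟙 e ∘ f)

  𝟙-cong : (d : Dec P) (e : Dec Q) → (P → Q) → (Q → P) → 𝟙 d ≡ 𝟙 e
  𝟙-cong d e f g = ≤-antisym (𝟙-mono d e f) (𝟙-mono e d g)

  𝟙+𝟙¬ : (d : Dec P) → 𝟙 d + 𝟙 (¬? d) ≡ 1
  𝟙+𝟙¬ (yes _) = refl
  𝟙+𝟙¬ (no _) = refl

  ∑ : List A → (A → ℕ) → ℕ
  ∑ [] f = 0
  ∑ (x ∷ xs) f = f x + ∑ xs f

  ∑-cong : (xs : List A) {f g : A → ℕ} → (∀ x → f x ≡ g x) → ∑ xs f ≡ ∑ xs g
  ∑-cong [] h = refl
  ∑-cong (x ∷ xs) h = cong₂ _+_ (h x) (∑-cong xs h)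

  ∑-mono-∈ : (xs : List A) {f g : A → ℕ} → (∀ {x} → x ∈ xs → f x ≤ g x) → ∑ xs f ≤ ∑ xs g
  ∑-mono-∈ [] h = z≤n
  ∑-mono-∈ (x ∷ xs) h = +-mono-≤ (h (here refl)) (∑-mono-∈ xs (h ∘ there))

  ∑-mono : (xs : List A) {f g : A → ℕ} → (∀ x → f x ≤ g x) → ∑ xs f ≤ ∑ xs g
  ∑-mono xs h = ∑-mono-∈ xs (λ {x} _ → h x)

  ∑-const : (xs : List A) (n : ℕ) → ∑ xs (λ _ → n) ≡ length xs * n
  ∑-const [] n = refl
  ∑-const (x ∷ xs) n = cong (n +_) (∑-const xs n)

  ∑-1 : (xs : List A) → ∑ xs (λ _ → 1) ≡ length xs
  ∑-1 xs = trans (∑-const xs 1) (*-identityʳ _)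

  ∑-0 : (xs : List A) → ∑ xs (λ _ → 0) ≡ 0
  ∑-0 xs = trans (∑-const xs 0) (*-zeroʳ (length xs))

  ∑-+ : (xs : List A) (f g : A → ℕ) → ∑ xs (λ x → f x + g x) ≡ ∑ xs f + ∑ xs g
  ∑-+ [] f g = refl
  ∑-+ (x ∷ xs) f g rewrite ∑-+ xs f g = interchange (f x) (g x) (∑ xs f) (∑ xs g)
    where
    interchange : ∀ m n s t → m + n + (s + t) ≡ m + s + (n + t)
    interchange = solve-∀

  ∑-*ˡ : (xs : List A) (n : ℕ) (f : A → ℕ) → ∑ xs (λ x → n * f x) ≡ n * ∑ xs f
  ∑-*ˡ [] n f = sym (*-zeroʳ n)
  ∑-*ˡ (x ∷ xs) n f rewrite ∑-*ˡ xs n f = sym (*-distribˡ-+ n (f x) (∑ xs f))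

  ∑-*ʳ : (xs : List A) (n : ℕ) (f : A → ℕ) → ∑ xs (λ x → f x * n) ≡ ∑ xs f * n
  ∑-*ʳ [] n f = refl
  ∑-*ʳ (x ∷ xs) n f rewrite ∑-*ʳ xs n f = sym (*-distribʳ-+ n (f x) (∑ xs f))

  ∑-swap : (xs : List A) (ys : List B) (f : A → B → ℕ) →
           ∑ xs (λ x → ∑ ys (f x)) ≡ ∑ ys (λ y → ∑ xs (λ x → f x y))
  ∑-swap [] ys f = sym (∑-0 ys)
  ∑-swap (x ∷ xs) ys f rewrite ∑-swap xs ys f = sym (∑-+ ys (f x) _)

  ∑-++ : (xs ys : List A) (f : A → ℕ) → ∑ (xs ++ ys) f ≡ ∑ xs f + ∑ ys f
  ∑-++ [] ys f = refl
  ∑-++ (x ∷ xs) ys f rewrite ∑-++ xs ys f = sym (+-assoc (f x) _ _)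

  ∑-map : (g : A → B) (xs : List A) (f : B → ℕ) → ∑ (map g xs) f ≡ ∑ xs (f ∘ g)
  ∑-map g [] f = refl
  ∑-map g (x ∷ xs) f = cong (f (g x) +_) (∑-map g xs f)

  ∑-concatMap : (g : A → List B) (xs : List A) (f : B → ℕ) →
                ∑ (concatMap g xs) f ≡ ∑ xs (λ x → ∑ (g x) f)
  ∑-concatMap g [] f = refl
  ∑-concatMap g (x ∷ xs) f =
    trans (∑-++ (g x) (concatMap g xs) f) (cong (∑ (g x) f +_) (∑-concatMap g xs f))

  ∑-filter : {P : A → Set p} (P? : Decidable P) (xs : List A) (f : A → ℕ) →
             ∑ (filter P? xs) f ≡ ∑ xs (λ x → 𝟙 (P? x) * f x)
  ∑-filter P? [] f = refl
  ∑-filter P? (x ∷ xs) f with P? x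
  ... | yes _ = cong₂ _+_ (sym (+-identityʳ (f x))) (∑-filter P? xs f)
  ... | no _ = ∑-filter P? xs f

  length-filter : {P : A → Set p} (P? : Decidable P) (xs : List A) →
                  length (filter P? xs) ≡ ∑ xs (𝟙 ∘ P?)
  length-filter P? xs = trans (sym (∑-1 (filter P? xs))) (trans (∑-filter P? xs _) (∑-cong xs (λ x → *-identityʳ _)))

  ∑-filter-≤ : {P : A → Set p} (P? : Decidable P) (xs : List A) (f : A → ℕ) → ∑ (filter P? xs) f ≤ ∑ xs f
  ∑-filter-≤ P? xs f = ≤-trans (≤-reflexive (∑-filter P? xs f)) (∑-mono xs (λ x → 𝟙*≤ (P? x) (λ _ → ≤-refl)))

  Any⇒1≤∑ : {P : A → Set p} (P? : Decidable P) {xs : List A} → Any P xs → 1 ≤ ∑ xs (𝟙 ∘ P?)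
  Any⇒1≤∑ P? (here {x = x} px) = ≤-trans (1≤𝟙 (P? x) px) (m≤m+n _ _)
  Any⇒1≤∑ P? (there {x = x} pxs) = ≤-trans (Any⇒1≤∑ P? pxs) (m≤n+m _ (𝟙 (P? x)))

  ∑≡0 : {P : A → Set p} (P? : Decidable P) (xs : List A) → (∀ {x} → x ∈ xs → ¬ P x) → ∑ xs (𝟙 ∘ P?) ≡ 0
  ∑≡0 P? xs h = n≤0⇒n≡0 (≤-trans (∑-mono-∈ xs (λ x∈ → ≤-reflexive (𝟙-no (P? _) (h x∈)))) (≤-reflexive (∑-0 xs)))

  AllPairs⇒∑≤1-∈ : {R : Rel A r} {P : A → Set p} (P? : Decidable P) {xs : List A} → AllPairs R xs →
                   (∀ {x y} → x ∈ xs → y ∈ xs → R x y → P x → P y → ⊥) → ∑ xs (𝟙 ∘ P?) ≤ 1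
  AllPairs⇒∑≤1-∈ P? [] h = z≤n
  AllPairs⇒∑≤1-∈ P? {x ∷ xs} (Rx ∷ Rxs) h with P? x
  ... | yes px = s≤s (≤-reflexive (∑≡0 P? xs (λ y∈ py → h (here refl) (there y∈) (All.lookup Rx y∈) px py)))
  ... | no _ = AllPairs⇒∑≤1-∈ P? Rxs (λ x∈ y∈ → h (there x∈) (there y∈))

  AllPairs⇒∑≤1 : {R : Rel A r} {P : A → Set p} (P? : Decidable P) {xs : List A} → AllPairs R xs →
                 (∀ {x y} → R x y → P x → P y → ⊥) → ∑ xs (𝟙 ∘ P?) ≤ 1
  AllPairs⇒∑≤1 P? pairs h = AllPairs⇒∑≤1-∈ P? pairs (λ _ _ → h)

  deduplicate-AllPairs : {R : Rel A r} (R? : Decidable₂ R) (xs : List A) →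
                         AllPairs (λ x y → ¬ R x y) (deduplicate R? xs)
  deduplicate-AllPairs R? [] = []
  deduplicate-AllPairs R? (x ∷ xs) =
    All.all-filter _ (deduplicate R? xs) ∷ AllPairs.filter⁺ _ (deduplicate-AllPairs R? xs)

  -- Each `x` is charged to a related `y`, and no `y` is charged twice. A relation in place of a
  -- function lets the targets be taken up to a setoid equality, without a choice of
  -- representatives.
  ∑-inject : {R : A → B → Set r} (R? : Decidable₂ R) (xs : List A) (ys : List B) {f : A → ℕ} {g : B → ℕ} →
             (∀ {x} → x ∈ xs → Any (R x) ys) → (∀ y → ∑ xs (λ x → 𝟙 (R? x y)) ≤ 1) →
             (∀ {x y} → R x y → f x ≤ g y) → ∑ xs f ≤ ∑ ys g
  ∑-inject R? xs ys {f} {g} total injective f≤g = begin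
    ∑ xs f                                  ≤⟨ ∑-mono-∈ xs bound ⟩
    ∑ xs (λ x → ∑ ys (λ y → 𝟙 (R? x y) * g y)) ≡⟨ ∑-swap xs ys _ ⟩
    ∑ ys (λ y → ∑ xs (λ x → 𝟙 (R? x y) * g y)) ≡⟨ ∑-cong ys (λ y → ∑-*ʳ xs (g y) _) ⟩
    ∑ ys (λ y → ∑ xs (λ x → 𝟙 (R? x y)) * g y) ≤⟨ ∑-mono ys (λ y → ≤-trans (*-monoˡ-≤ (g y) (injective y)) (≤-reflexive (*-identityˡ (g y)))) ⟩
    ∑ ys g                                  ∎
    where
    open ≤-Reasoning
    bound : ∀ {x} → x ∈ xs → f x ≤ ∑ ys (λ y → 𝟙 (R? x y) * g y)
    bound {x} x∈ = begin
      f x                              ≡⟨ *-identityˡ (f x) ⟨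
      1 * f x                          ≤⟨ *-monoˡ-≤ (f x) (Any⇒1≤∑ (R? x) (total x∈)) ⟩
      ∑ ys (λ y → 𝟙 (R? x y)) * f x    ≡⟨ ∑-*ʳ ys (f x) _ ⟨
      ∑ ys (λ y → 𝟙 (R? x y) * f x)    ≤⟨ ∑-mono ys (λ y → 𝟙*≤ (R? x y) (λ Rxy → ≤-trans (f≤g Rxy) (≤-reflexive (sym (trans (cong (_* g y) (𝟙-yes (R? x y) Rxy)) (*-identityˡ (g y))))))) ⟩
      ∑ ys (λ y → 𝟙 (R? x y) * g y)    ∎

  2mn≤m²+n² : ∀ m n → 2 * (m * n) ≤ m * m + n * n
  2mn≤m²+n² m n with ≤-total m n
  ... | inj₁ m≤n = subst (λ n → 2 * (m * n) ≤ m * m + n * n) (m+[n∸m]≡n m≤n)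
                     (≤-trans (m≤m+n _ ((n ∸ m) * (n ∸ m))) (≤-reflexive (square m (n ∸ m))))
    where
    square : ∀ m k → 2 * (m * (m + k)) + k * k ≡ m * m + (m + k) * (m + k)
    square = solve-∀
  ... | inj₂ n≤m = subst (λ m → 2 * (m * n) ≤ m * m + n * n) (m+[n∸m]≡n n≤m)
                     (≤-trans (m≤m+n _ ((m ∸ n) * (m ∸ n))) (≤-reflexive (square n (m ∸ n))))
    where
    square : ∀ n k → 2 * ((n + k) * n) + k * k ≡ (n + k) * (n + k) + n * n
    square = solve-∀

  -- Cauchy-Schwarz against the constant function 1, obtained by summing `2mn≤m²+n²` over all pairs
  -- of entries.
  ∑²≤ : (xs : List A) (h : A → ℕ) → ∑ xs h * ∑ xs h ≤ length xs * ∑ xs (λ x → h x * h x)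
  ∑²≤ xs h = *-cancelˡ-≤ 2 (begin
    2 * (∑ xs h * ∑ xs h)                          ≡⟨ cong (2 *_) (∑-*ʳ xs (∑ xs h) h) ⟨
    2 * ∑ xs (λ x → h x * ∑ xs h)                  ≡⟨ ∑-*ˡ xs 2 _ ⟨
    ∑ xs (λ x → 2 * (h x * ∑ xs h))                ≡⟨ ∑-cong xs (λ x → trans (cong (2 *_) (sym (∑-*ˡ xs (h x) h))) (sym (∑-*ˡ xs 2 _))) ⟩
    ∑ xs (λ x → ∑ xs (λ y → 2 * (h x * h y)))      ≤⟨ ∑-mono xs (λ x → ∑-mono xs (λ y → 2mn≤m²+n² (h x) (h y))) ⟩
    ∑ xs (λ x → ∑ xs (λ y → h x * h x + h y * h y)) ≡⟨ ∑-cong xs (λ x → trans (∑-+ xs _ _) (cong (_+ S) (∑-const xs (h x * h x)))) ⟩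
    ∑ xs (λ x → length xs * (h x * h x) + S)       ≡⟨ ∑-+ xs _ _ ⟩
    ∑ xs (λ x → length xs * (h x * h x)) + ∑ xs (λ _ → S) ≡⟨ cong₂ _+_ (∑-*ˡ xs (length xs) _) (∑-const xs S) ⟩
    length xs * S + length xs * S                  ≡⟨ cong (length xs * S +_) (sym (+-identityʳ _)) ⟩
    2 * (length xs * S)                            ∎)
    where
    open ≤-Reasoning
    S : ℕ
    S = ∑ xs (λ x → h x * h x)

  -- With `h t` the number of entries labelled `t`, the sum of `h` is at least `length ys`, and the
  -- sum of its squares counts pairs with a common label, each of which collides. By Cauchy-Schwarz,
  -- few labels force many collisions.
  collisions : {L : A → B → Set r} (L? : Decidable₂ L) {C : Rel A p} (C? : Decidable₂ C)
               (ys : List A) (ts : List B) →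
               (∀ {y} → y ∈ ys → Any (L y) ts) → (∀ y → ∑ ts (λ t → 𝟙 (L? y t)) ≤ 1) →
               (∀ {y z t} → L y t → L z t → C y z) →
               length ys * length ys ≤ length ts * ∑ ys (λ y → ∑ ys (λ z → 𝟙 (C? y z)))
  collisions L? C? ys ts total functional collide = begin
    length ys * length ys                              ≤⟨ *-mono-≤ ys≤ ys≤ ⟩
    ∑ ts h * ∑ ts h                                    ≤⟨ ∑²≤ ts h ⟩
    length ts * ∑ ts (λ t → h t * h t)                 ≤⟨ *-monoʳ-≤ (length ts) squares ⟩
    length ts * ∑ ys (λ y → ∑ ys (λ z → 𝟙 (C? y z)))   ∎
    where
    open ≤-Reasoning
    h : _ → ℕ
    h t = ∑ ys (λ y → 𝟙 (L? y t))
    ys≤ : length ys ≤ ∑ ts h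
    ys≤ = begin
      length ys                             ≡⟨ ∑-1 ys ⟨
      ∑ ys (λ _ → 1)                        ≤⟨ ∑-mono-∈ ys (λ {y} y∈ → Any⇒1≤∑ (L? y) (total y∈)) ⟩
      ∑ ys (λ y → ∑ ts (λ t → 𝟙 (L? y t)))  ≡⟨ ∑-swap ys ts _ ⟩
      ∑ ts h                                ∎
    squares : ∑ ts (λ t → h t * h t) ≤ ∑ ys (λ y → ∑ ys (λ z → 𝟙 (C? y z)))
    squares = begin
      ∑ ts (λ t → h t * h t)
        ≡⟨ ∑-cong ts (λ t → trans (sym (∑-*ʳ ys (h t) _)) (∑-cong ys (λ y → sym (∑-*ˡ ys (𝟙 (L? y t)) _)))) ⟩
      ∑ ts (λ t → ∑ ys (λ y → ∑ ys (λ z → 𝟙 (L? y t) * 𝟙 (L? z t))))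
        ≡⟨ ∑-swap ts ys _ ⟩
      ∑ ys (λ y → ∑ ts (λ t → ∑ ys (λ z → 𝟙 (L? y t) * 𝟙 (L? z t))))
        ≡⟨ ∑-cong ys (λ y → ∑-swap ts ys _) ⟩
      ∑ ys (λ y → ∑ ys (λ z → ∑ ts (λ t → 𝟙 (L? y t) * 𝟙 (L? z t))))
        ≤⟨ ∑-mono ys (λ y → ∑-mono ys (λ z → pair y z)) ⟩
      ∑ ys (λ y → ∑ ys (λ z → 𝟙 (C? y z))) ∎
      where
      pair : ∀ y z → ∑ ts (λ t → 𝟙 (L? y t) * 𝟙 (L? z t)) ≤ 𝟙 (C? y z)
      pair y z = begin
        ∑ ts (λ t → 𝟙 (L? y t) * 𝟙 (L? z t))
          ≤⟨ ∑-mono ts (λ t → 𝟙*≤ (L? y t) (λ Lyt → 𝟙≤ (L? z t) (λ Lzt →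
               *-mono-≤ (1≤𝟙 (L? y t) Lyt) (1≤𝟙 (C? y z) (collide Lyt Lzt))))) ⟩
        ∑ ts (λ t → 𝟙 (L? y t) * 𝟙 (C? y z))  ≡⟨ ∑-*ʳ ts _ _ ⟩
        ∑ ts (λ t → 𝟙 (L? y t)) * 𝟙 (C? y z)  ≤⟨ *-monoˡ-≤ (𝟙 (C? y z)) (functional y) ⟩
        1 * 𝟙 (C? y z)                        ≡⟨ *-identityˡ _ ⟩
        𝟙 (C? y z)                            ∎

  average-≤ : (xs : List A) {f g : A → ℕ} → 0 < length xs → ∑ xs f ≤ ∑ xs g →
              ∃ λ x → x ∈ xs × f x ≤ g x
  average-≤ xs@(x ∷ ys) {f} {g} _ h with Any.any? (λ y → f y ≤? g y) xs
  ... | yes some = find some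
  ... | no none = ⊥-elim (<⇒≱ (+-mono-<-≤ (above (here refl)) (∑-mono-∈ ys (<⇒≤ ∘ above ∘ there))) h)
    where
    above : ∀ {y} → y ∈ xs → g y < f y
    above y∈ = ≰⇒> (none ∘ lose y∈)

  -- Each new element adds a row and an equal column to the matrix of the relation, while its
  -- diagonal entry is 0.
  handshake : ∀ {a r} {A : Set a} {R : Rel A r} (R? : Decidable₂ R) →
              (∀ {x y} → R x y → R y x) → (∀ {x} → ¬ R x x) → (xs : List A) →
              2 ∣ ∑ xs (λ x → ∑ xs (λ y → 𝟙 (R? x y)))
  handshake R? R-sym irrefl [] = 2 ∣0
  handshake R? R-sym irrefl (x ∷ xs) =
    subst (2 ∣_) (sym double) (∣m∣n⇒∣m+n (divides N (*-comm 2 N)) (handshake R? R-sym irrefl xs))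
    where
    N : ℕ
    N = ∑ xs (λ y → 𝟙 (R? x y))
    rearrange : ∀ n s → n + (n + s) ≡ 2 * n + s
    rearrange = solve-∀
    double : ∑ (x ∷ xs) (λ y → ∑ (x ∷ xs) (λ z → 𝟙 (R? y z))) ≡ 2 * N + ∑ xs (λ y → ∑ xs (λ z → 𝟙 (R? y z)))
    double rewrite 𝟙-no (R? x x) irrefl
                 | ∑-+ xs (λ y → 𝟙 (R? y x)) (λ y → ∑ xs (λ z → 𝟙 (R? y z)))
                 | ∑-cong xs (λ y → 𝟙-cong (R? y x) (R? x y) R-sym R-sym) = rearrange N _

  ∈-take⁻ : ∀ {a} {A : Set a} n {xs : List A} {x} → x ∈ take n xs → x ∈ xs
  ∈-take⁻ n = All.lookup (All.take⁺ n (All.tabulate (λ x∈ → x∈)))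

-- Ring solving with integer coefficients

-- The stock solver over an abstract ring cannot see that its coefficients cancel, so the
-- coefficients here are integers, encoded as normalised differences (m , n) = m - n of naturals.
module IntegerCoefficients {c ℓ : Level} (R : CommutativeRing c ℓ) where
  open import Algebra.Solver.Ring.AlmostCommutativeRing using (fromCommutativeRing; _-Raw-AlmostCommutative⟶_)
  import Algebra.Solver.Ring as RingSolver
  import Algebra.Properties.Ring as RingProperties
  import Algebra.Properties.Semiring.Mult as Multiples
  import Relation.Binary.Reasoning.Setoid as SetoidReasoning
  open import Data.Maybe using (Maybe; just; nothing)
  open import Data.Nat as ℕ using (_∸_)
  import Data.Nat.Properties as ℕ
  open import Data.Product using (_×_; _,_)
  open import Data.Sum using (inj₁; inj₂)
  open import Relation.Nullary using (yes)
  import Relation.Binary.PropositionalEquality as ≡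

  open CommutativeRing R
  open RingProperties ring
  open Multiples semiring renaming (_×_ to _×′_)
  open SetoidReasoning setoid

  -- One component becomes 0, so equal integers become identical pairs, which `coefficient≟`
  -- recognises.
  normal : ℕ × ℕ → ℕ × ℕ
  normal (m , n) = m ∸ n , n ∸ m

  differences : RawRing _ _
  differences = record
    { Carrier = ℕ × ℕ
    ; _≈_ = ≡._≡_
    ; _+_ = λ { (k , l) (m , n) → normal (k ℕ.+ m , l ℕ.+ n) }
    ; _*_ = λ { (k , l) (m , n) → normal (k ℕ.* m ℕ.+ l ℕ.* n , k ℕ.* n ℕ.+ l ℕ.* m) }
    ; -_ = λ { (m , n) → n , m }
    ; 0# = 0 , 0
    ; 1# = 1 , 0
    }

  ⟦_⟧ : ℕ × ℕ → Carrier
  ⟦ m , n ⟧ = m ×′ 1# - n ×′ 1#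

  shift : ∀ m n → ⟦ n ℕ.+ m , n ⟧ ≈ ⟦ m , 0 ⟧
  shift m n = begin
    (n ℕ.+ m) ×′ 1# - n ×′ 1#          ≈⟨ +-congʳ (×-homo-+ 1# n m) ⟩
    n ×′ 1# + m ×′ 1# - n ×′ 1#        ≈⟨ xyx⁻¹≈y _ _ ⟩
    m ×′ 1#                            ≈⟨ +-identityʳ _ ⟨
    m ×′ 1# + 0#                       ≈⟨ +-congˡ -0#≈0# ⟨
    m ×′ 1# - 0#                       ∎

  negate : ∀ m n → ⟦ n , m ⟧ ≈ - ⟦ m , n ⟧
  negate m n = begin
    n ×′ 1# - m ×′ 1#        ≈⟨ +-comm _ _ ⟩
    - (m ×′ 1#) + n ×′ 1#    ≈⟨ +-congˡ (-‿involutive _) ⟨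
    - (m ×′ 1#) - - (n ×′ 1#) ≈⟨ -‿+-comm _ _ ⟩
    - (m ×′ 1# - n ×′ 1#)    ∎

  ⟦normal⟧ : ∀ m n → ⟦ normal (m , n) ⟧ ≈ ⟦ m , n ⟧
  ⟦normal⟧ m n with ℕ.≤-total n m
  ... | inj₁ n≤m rewrite ℕ.m≤n⇒m∸n≡0 n≤m = begin
    ⟦ m ∸ n , 0 ⟧          ≈⟨ shift (m ∸ n) n ⟨
    ⟦ n ℕ.+ (m ∸ n) , n ⟧  ≡⟨ ≡.cong (λ k → ⟦ k , n ⟧) (ℕ.m+[n∸m]≡n n≤m) ⟩
    ⟦ m , n ⟧              ∎
  ... | inj₂ m≤n rewrite ℕ.m≤n⇒m∸n≡0 m≤n = begin
    ⟦ 0 , n ∸ m ⟧            ≈⟨ negate (n ∸ m) 0 ⟩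
    - ⟦ n ∸ m , 0 ⟧          ≈⟨ -‿cong (shift (n ∸ m) m) ⟨
    - ⟦ m ℕ.+ (n ∸ m) , m ⟧  ≡⟨ ≡.cong (λ k → - ⟦ k , m ⟧) (ℕ.m+[n∸m]≡n m≤n) ⟩
    - ⟦ n , m ⟧              ≈⟨ negate n m ⟨
    ⟦ m , n ⟧                ∎

  interchange : ∀ w x y z → (w + x) + (y + z) ≈ (w + y) + (x + z)
  interchange w x y z = begin
    (w + x) + (y + z) ≈⟨ +-assoc w x (y + z) ⟩
    w + (x + (y + z)) ≈⟨ +-congˡ (+-assoc x y z) ⟨
    w + ((x + y) + z) ≈⟨ +-congˡ (+-congʳ (+-comm x y)) ⟩
    w + ((y + x) + z) ≈⟨ +-congˡ (+-assoc y x z) ⟩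
    w + (y + (x + z)) ≈⟨ +-assoc w y (x + z) ⟨
    (w + y) + (x + z) ∎

  +-homo : ∀ k l m n → ⟦ k ℕ.+ m , l ℕ.+ n ⟧ ≈ ⟦ k , l ⟧ + ⟦ m , n ⟧
  +-homo k l m n = begin
    (k ℕ.+ m) ×′ 1# - (l ℕ.+ n) ×′ 1#
      ≈⟨ +-cong (×-homo-+ 1# k m) (-‿cong (×-homo-+ 1# l n)) ⟩
    (k ×′ 1# + m ×′ 1#) - (l ×′ 1# + n ×′ 1#)
      ≈⟨ +-congˡ (-‿+-comm _ _) ⟨
    (k ×′ 1# + m ×′ 1#) + (- (l ×′ 1#) - n ×′ 1#)
      ≈⟨ interchange _ _ _ _ ⟩
    (k ×′ 1# - l ×′ 1#) + (m ×′ 1# - n ×′ 1#) ∎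

  scale-homo : ∀ k m n → ⟦ k ℕ.* m , k ℕ.* n ⟧ ≈ k ×′ 1# * ⟦ m , n ⟧
  scale-homo k m n = begin
    (k ℕ.* m) ×′ 1# - (k ℕ.* n) ×′ 1#              ≈⟨ +-cong (×1-homo-* k m) (-‿cong (×1-homo-* k n)) ⟩
    k ×′ 1# * m ×′ 1# - k ×′ 1# * n ×′ 1#          ≈⟨ x[y-z]≈xy-xz _ _ _ ⟨
    k ×′ 1# * (m ×′ 1# - n ×′ 1#)                  ∎

  *-homo : ∀ k l m n → ⟦ k ℕ.* m ℕ.+ l ℕ.* n , k ℕ.* n ℕ.+ l ℕ.* m ⟧ ≈ ⟦ k , l ⟧ * ⟦ m , n ⟧
  *-homo k l m n = begin
    ⟦ k ℕ.* m ℕ.+ l ℕ.* n , k ℕ.* n ℕ.+ l ℕ.* m ⟧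
      ≈⟨ +-homo (k ℕ.* m) (k ℕ.* n) (l ℕ.* n) (l ℕ.* m) ⟩
    ⟦ k ℕ.* m , k ℕ.* n ⟧ + ⟦ l ℕ.* n , l ℕ.* m ⟧
      ≈⟨ +-cong (scale-homo k m n) (trans (negate (l ℕ.* m) (l ℕ.* n)) (-‿cong (scale-homo l m n))) ⟩
    k ×′ 1# * ⟦ m , n ⟧ - l ×′ 1# * ⟦ m , n ⟧
      ≈⟨ [y-z]x≈yx-zx _ _ _ ⟨
    ⟦ k , l ⟧ * ⟦ m , n ⟧ ∎

  morphism : differences -Raw-AlmostCommutative⟶ fromCommutativeRing R
  morphism = record
    { ⟦_⟧ = ⟦_⟧
    ; +-homo = λ { (k , l) (m , n) → trans (⟦normal⟧ (k ℕ.+ m) (l ℕ.+ n)) (+-homo k l m n) }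
    ; *-homo = λ { (k , l) (m , n) → trans (⟦normal⟧ (k ℕ.* m ℕ.+ l ℕ.* n) (k ℕ.* n ℕ.+ l ℕ.* m)) (*-homo k l m n) }
    ; -‿homo = λ { (m , n) → negate m n }
    ; 0-homo = -‿inverseʳ 0#
    ; 1-homo = trans (+-cong (+-identityʳ 1#) -0#≈0#) (+-identityʳ 1#)
    }

  coefficient≟ : ∀ x y → Maybe (⟦ x ⟧ ≈ ⟦ y ⟧)
  coefficient≟ (k , l) (m , n) with k ℕ.≟ m | l ℕ.≟ n
  ... | yes ≡.refl | yes ≡.refl = just refl
  ... | _ | _ = nothing

  open RingSolver differences (fromCommutativeRing R) morphism coefficient≟ public
    using (_:=_; _:+_; _:*_; _:-_; :-_; solve)

-- The two numerical contradictions

module Arithmetic where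
  open import Data.Nat using (suc; _+_; _*_; _∸_; _≤_; _<_; z≤n; s≤s; >-nonZero)
  open import Data.Nat.Properties hiding (_≟_)
  open import Data.Nat.Tactic.RingSolver using (solve-∀)
  open import Data.Empty using (⊥)
  open import Relation.Binary.PropositionalEquality using (_≡_; refl; sym; trans; cong; subst)

  -- In the application `n` counts the points, `z` is q - 1, and `y` counts the isotropic
  -- differences from one point. With `w = y ∸ κ > Q + 3 * κ`, the quantity w² - Q² is at least (3κ
  -- + 1)w, hence larger than y² - w²; but `energy` says that z(w² - Q²) ≤ y² - w².
  clique-arithmetic : ∀ {m κ Q n y z} → 0 < Q → 0 < z → 6 * (m * κ) ≤ Q → suc m * Q ≤ m * n → n ≤ y + κ →
                      (y ∸ κ) * (y ∸ κ) * suc z ≤ y * y + z * (Q * Q) → ⊥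
  clique-arithmetic {m} {κ} {Q} {n} {y} {z} 0<Q 0<z 6mκ≤Q large n≤ energy = <⇒≱ above energy′
    where
    open ≤-Reasoning
    -- Otherwise `Q ≤ 5 * (m * κ)`, although `6 * (m * κ) ≤ Q`.
    y> : Q + 4 * κ < y
    y> = ≰⇒> λ y≤ → <⇒≱ 0<Q (+-cancelˡ-≤ (5 * Q) Q 0 (begin
      5 * Q + Q          ≡⟨ six Q ⟩
      6 * Q              ≤⟨ *-monoʳ-≤ 6 (+-cancelˡ-≤ (m * Q) Q (5 * (m * κ)) (begin
        m * Q + Q            ≡⟨ +-comm (m * Q) Q ⟩
        suc m * Q            ≤⟨ large ⟩
        m * n                ≤⟨ *-monoʳ-≤ m (≤-trans n≤ (+-monoˡ-≤ κ y≤)) ⟩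
        m * (Q + 4 * κ + κ)  ≡⟨ collect m Q κ ⟩
        m * Q + 5 * (m * κ)  ∎)) ⟩
      6 * (5 * (m * κ))  ≡⟨ exchange (m * κ) ⟩
      5 * (6 * (m * κ))  ≤⟨ *-monoʳ-≤ 5 6mκ≤Q ⟩
      5 * Q              ≡⟨ +-identityʳ (5 * Q) ⟨
      5 * Q + 0          ∎))
      where
      six : ∀ Q → 5 * Q + Q ≡ 6 * Q
      six = solve-∀
      collect : ∀ m Q κ → m * (Q + 4 * κ + κ) ≡ m * Q + 5 * (m * κ)
      collect = solve-∀
      exchange : ∀ x → 6 * (5 * x) ≡ 5 * (6 * x)
      exchange = solve-∀
    w : ℕ
    w = y ∸ κ
    y≡w+κ : w + κ ≡ y
    y≡w+κ = m∸n+n≡m (≤-trans (≤-trans (m≤m+n κ (3 * κ)) (m≤n+m (4 * κ) Q)) (<⇒≤ y>))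
    w> : suc (Q + 3 * κ) ≤ w
    w> = +-cancelʳ-≤ κ _ w (begin
      suc (Q + 3 * κ) + κ   ≡⟨ shift Q κ ⟩
      suc (Q + 4 * κ)       ≤⟨ y> ⟩
      y                     ≡⟨ y≡w+κ ⟨
      w + κ                 ∎)
      where
      shift : ∀ Q κ → suc (Q + 3 * κ) + κ ≡ suc (Q + 4 * κ)
      shift = solve-∀
    κ≤w : κ ≤ w
    κ≤w = ≤-trans (≤-trans (m≤m+n κ (2 * κ)) (m≤n+m (3 * κ) (suc Q))) w>
    energy′ : w * w * suc z ≤ (w + κ) * (w + κ) + z * (Q * Q)
    energy′ = subst (λ x → w * w * suc z ≤ x * x + z * (Q * Q)) (sym y≡w+κ) energy
    above : (w + κ) * (w + κ) + z * (Q * Q) < w * w * suc z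
    above = begin-strict
      (w + κ) * (w + κ) + z * (Q * Q)
        ≡⟨ cong (_+ z * (Q * Q)) (square w κ) ⟩
      w * w + (2 * κ * w + κ * κ) + z * (Q * Q)
        ≤⟨ +-monoˡ-≤ (z * (Q * Q)) (+-monoʳ-≤ (w * w) (+-monoʳ-≤ (2 * κ * w) (*-monoʳ-≤ κ κ≤w))) ⟩
      w * w + (2 * κ * w + κ * w) + z * (Q * Q)
        <⟨ +-monoˡ-< (z * (Q * Q)) (+-monoʳ-< (w * w) (≤-reflexive-< (triple κ w))) ⟩
      w * w + suc (3 * κ) * w + z * (Q * Q)
        ≤⟨ +-monoˡ-≤ (z * (Q * Q)) (+-monoʳ-≤ (w * w) (≤-trans (≤-reflexive (sym (*-identityˡ _))) (*-monoˡ-≤ (suc (3 * κ) * w) 0<z))) ⟩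
      w * w + z * (suc (3 * κ) * w) + z * (Q * Q)
        ≡⟨ gather (w * w) z (suc (3 * κ) * w) (Q * Q) ⟩
      w * w + z * (Q * Q + suc (3 * κ) * w)
        ≤⟨ +-monoʳ-≤ (w * w) (*-monoʳ-≤ z (begin
          Q * Q + suc (3 * κ) * w   ≤⟨ +-monoˡ-≤ (suc (3 * κ) * w) (*-monoʳ-≤ Q (≤-trans (m≤m+n Q (3 * κ)) (≤-trans (n≤1+n _) w>))) ⟩
          Q * w + suc (3 * κ) * w   ≡⟨ *-distribʳ-+ w Q (suc (3 * κ)) ⟨
          (Q + suc (3 * κ)) * w     ≡⟨ cong (_* w) (+-suc Q (3 * κ)) ⟩
          suc (Q + 3 * κ) * w       ≤⟨ *-monoˡ-≤ w w> ⟩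
          w * w                     ∎)) ⟩
      w * w + z * (w * w)
        ≡⟨ trans (cong (w * w +_) (*-comm z (w * w))) (sym (*-suc (w * w) z)) ⟩
      w * w * suc z ∎
      where
      square : ∀ w κ → (w + κ) * (w + κ) ≡ w * w + (2 * κ * w + κ * κ)
      square = solve-∀
      gather : ∀ a z b e → a + z * b + z * e ≡ a + z * (e + b)
      gather = solve-∀
      0<w : 0 < w
      0<w = ≤-trans (s≤s z≤n) w>
      triple : ∀ κ w → suc (2 * κ * w + κ * w) ≡ 1 + 3 * κ * w
      triple = solve-∀
      ≤-reflexive-< : suc (2 * κ * w + κ * w) ≡ 1 + 3 * κ * w → 2 * κ * w + κ * w < suc (3 * κ) * w
      ≤-reflexive-< eq = ≤-trans (≤-reflexive eq) (+-monoˡ-≤ (3 * κ * w) 0<w)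

  -- In the application `h` and `ℓ` count the light and the heavy points, `D` and `g` the directions
  -- and isotropic differences at one light point, and `T` the vectors that a projection should not
  -- kill. The hypotheses give `r * n ≤ Q * (r + 8)`, whereas `large` gives `r * n ≥ Q * (r + 12)`,
  -- because `r = 12 * m`.
  few-directions-arithmetic : ∀ {m r n h ℓ D g T Q} → r ≡ 12 * m → 0 < m → 0 < Q → n ≤ 2 * Q → suc m * Q ≤ m * n →
                              h + ℓ ≡ n → ℓ ≤ g + D * (r * 2) → r * g ≤ n → r * suc r * D ≤ Q → Q * h ≤ T + Q * Q →
                              r * suc r * r * T ≤ h * (r * Q + r * suc r * n) → ⊥
  few-directions-arithmetic {m} {r} {n} {h} {ℓ} {D} {g} {T} {Q} refl 0<m 0<Q n≤2Q large h+ℓ ℓ≤ g≤ D≤ h≤ T≤ =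
    <⇒≱ (*-monoˡ-< m {{>-nonZero 0<m}} {8} {12} (m≤m+n 9 3)) (*-cancelʳ-≤ (12 * m) (8 * m) Q {{>-nonZero 0<Q}} (+-cancelˡ-≤ (m * r * Q) _ _ (begin
      m * r * Q + r * Q      ≡⟨ factor m r Q ⟩
      r * (suc m * Q)        ≤⟨ *-monoʳ-≤ r large ⟩
      r * (m * n)            ≡⟨ exchange r m n ⟩
      m * (r * n)            ≤⟨ *-monoʳ-≤ m (*-cancelˡ-≤ (K * Q) {{>-nonZero (*-mono-≤ (*-mono-≤ 0<r (s≤s (z≤n {r}))) 0<Q)}} total) ⟩
      m * (Q * (r + 8))      ≡⟨ expand m Q r ⟩
      m * r * Q + 8 * m * Q  ∎)))
    where
    open ≤-Reasoning
    split : ∀ K Q r h ℓ → K * Q * (r * (h + ℓ)) ≡ K * r * (Q * h) + K * r * Q * ℓ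
    split = solve-∀
    regroup : ∀ K r T Q g D → K * r * (T + Q * Q) + K * r * Q * (g + D * (r * 2))
              ≡ K * r * T + (K * r * (Q * Q) + K * Q * (r * g) + 2 * r * r * Q * (K * D))
    regroup = solve-∀
    finish : ∀ r Q → 2 * Q * (r * Q + r * suc r * (2 * Q)) + (r * suc r * r * (Q * Q) + r * suc r * Q * (2 * Q) + 2 * r * r * Q * Q)
             ≡ r * suc r * Q * (Q * (r + 8))
    finish = solve-∀
    factor : ∀ m r Q → m * r * Q + r * Q ≡ r * (suc m * Q)
    factor = solve-∀
    exchange : ∀ r m n → r * (m * n) ≡ m * (r * n)
    exchange = solve-∀
    expand : ∀ m Q r → m * (Q * (r + 8)) ≡ m * r * Q + 8 * m * Q
    expand = solve-∀
    K : ℕ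
    K = r * suc r
    0<r : 0 < r
    0<r = ≤-trans 0<m (m≤m+n m _)
    -- In units of K Q², the image space contributes `r`. The rest is 8: the isotropic differences
    -- in `T` cost 4, the heavy points isotropic to the chosen light point cost 2, and the
    -- directions cost 2, since 2r + 2r² = 2K.
    total : K * Q * (r * n) ≤ K * Q * (Q * (r + 8))
    total = begin
      K * Q * (r * n)
        ≡⟨ trans (cong (λ n → K * Q * (r * n)) (sym h+ℓ)) (split K Q r h ℓ) ⟩
      K * r * (Q * h) + K * r * Q * ℓ
        ≤⟨ +-mono-≤ (*-monoʳ-≤ (K * r) h≤) (*-monoʳ-≤ (K * r * Q) ℓ≤) ⟩
      K * r * (T + Q * Q) + K * r * Q * (g + D * (r * 2))
        ≡⟨ regroup K r T Q g D ⟩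
      K * r * T + (K * r * (Q * Q) + K * Q * (r * g) + 2 * r * r * Q * (K * D))
        ≤⟨ +-mono-≤ (≤-trans T≤ (*-monoˡ-≤ (r * Q + K * n) (≤-trans (m≤m+n h ℓ) (≤-reflexive h+ℓ))))
             (+-mono-≤ (+-monoʳ-≤ (K * r * (Q * Q)) (*-monoʳ-≤ (K * Q) g≤)) (*-monoʳ-≤ (2 * r * r * Q) D≤)) ⟩
      n * (r * Q + K * n) + (K * r * (Q * Q) + K * Q * n + 2 * r * r * Q * Q)
        ≤⟨ +-mono-≤ (*-mono-≤ n≤2Q (+-monoʳ-≤ (r * Q) (*-monoʳ-≤ K n≤2Q)))
             (+-monoˡ-≤ (2 * r * r * Q * Q) (+-monoʳ-≤ (K * r * (Q * Q)) (*-monoʳ-≤ (K * Q) n≤2Q))) ⟩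
      2 * Q * (r * Q + K * (2 * Q)) + (K * r * (Q * Q) + K * Q * (2 * Q) + 2 * r * r * Q * Q)
        ≡⟨ finish r Q ⟩
      K * Q * (Q * (r + 8)) ∎

  -- For ε ≥ 1/m there are at least q^(d/2) / K directions, hence q / (2 (1 + K²)) spreads;
  -- this is the predecessor of 2 (1 + K²).
  spreadConstant : ℕ → ℕ
  spreadConstant m = suc (K * K * 2)
    where
    K : ℕ
    K = 12 * m * suc (12 * m)

-- Translation between rational and natural inequalities

module Rationals where
  open import Data.Nat as ℕ using (ℕ; zero; suc)
  import Data.Nat.Properties as ℕ
  open import Data.Nat.Tactic.RingSolver using (solve-∀)
  open import Data.Integer as ℤ using (ℤ; +_; -[1+_])
  import Data.Integer.Properties as ℤ
  open import Data.Rational as ℚ using (ℚ; mkℚ; 0ℚ; 1ℚ; toℚᵘ; *≤*; *<*) renaming (_/_ to _÷_)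
  import Data.Rational.Properties as ℚ
  open import Data.Rational.Unnormalised as ℚᵘ using (mkℚᵘ)
  import Data.Rational.Unnormalised.Properties as ℚᵘ
  open import Relation.Binary.PropositionalEquality using (_≡_; sym; trans; cong; subst₂)
  open import Data.Product using (∃; _×_; _,_)

  divide-≤ : ∀ C q n → q ℕ.≤ suc C ℕ.* n → ((+ 1) ÷ suc C) ℚ.* ((+ q) ÷ 1) ℚ.≤ (+ n) ÷ 1
  divide-≤ C q n q≤ = ℚ.toℚᵘ-cancel-≤ (begin
    toℚᵘ (((+ 1) ÷ suc C) ℚ.* ((+ q) ÷ 1))        ≃⟨ ℚ.toℚᵘ-homo-* ((+ 1) ÷ suc C) ((+ q) ÷ 1) ⟩
    toℚᵘ ((+ 1) ÷ suc C) ℚᵘ.* toℚᵘ ((+ q) ÷ 1)    ≃⟨ ℚᵘ.*-cong (ℚ.toℚᵘ-fromℚᵘ (mkℚᵘ (+ 1) C)) (ℚ.toℚᵘ-fromℚᵘ (mkℚᵘ (+ q) 0)) ⟩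
    mkℚᵘ (+ 1) C ℚᵘ.* mkℚᵘ (+ q) 0                ≤⟨ ℚᵘ.*≤* (subst₂ ℤ._≤_ left right (ℤ.+≤+ q≤)) ⟩
    mkℚᵘ (+ n) 0                                  ≃⟨ ℚ.toℚᵘ-fromℚᵘ (mkℚᵘ (+ n) 0) ⟨
    toℚᵘ ((+ n) ÷ 1)                              ∎)
    where
    open ℚᵘ.≤-Reasoning
    left : + q ≡ (+ 1 ℤ.* + q) ℤ.* + 1
    left = sym (trans (ℤ.*-identityʳ _) (ℤ.*-identityˡ (+ q)))
    right : + (suc C ℕ.* n) ≡ + n ℤ.* + (suc C ℕ.* 1)
    right = trans (cong +_ (trans (ℕ.*-comm (suc C) n) (cong (n ℕ.*_) (sym (ℕ.*-identityʳ (suc C)))))) (ℤ.pos-* n (suc C ℕ.* 1))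

  reciprocal-positive : ∀ C → 0ℚ ℚ.< (+ 1) ÷ suc C
  reciprocal-positive C = ℚ.toℚᵘ-cancel-< (ℚᵘ.<-respʳ-≃ (ℚᵘ.≃-sym (ℚ.toℚᵘ-fromℚᵘ (mkℚᵘ (+ 1) C))) (ℚᵘ.*<* (ℤ.+<+ (ℕ.s≤s ℕ.z≤n))))

  -- The denominator of ε serves as `m`: the numerator is at least 1, so 1/m ≤ ε.
  clear-denominators : ∀ ε → 0ℚ ℚ.< ε → ∃ λ m → 0 ℕ.< m × (∀ Q n → (1ℚ ℚ.+ ε) ℚ.* ((+ Q) ÷ 1) ℚ.≤ (+ n) ÷ 1 → suc m ℕ.* Q ℕ.≤ m ℕ.* n)
  clear-denominators (mkℚ (+ zero) b _) (*<* (ℤ.+<+ ()))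
  clear-denominators (mkℚ -[1+ _ ] b _) (*<* ())
  clear-denominators ε@(mkℚ (+ suc a) b _) _ = suc b , ℕ.s≤s ℕ.z≤n , bound
    where
    open ℚᵘ.≤-Reasoning
    expand : ∀ Q a b → (1 ℕ.* suc b ℕ.+ suc a ℕ.* 1) ℕ.* Q ℕ.* 1 ≡ suc (suc b) ℕ.* Q ℕ.+ a ℕ.* Q
    expand = solve-∀
    shrink : ∀ n b → n ℕ.* suc ((b ℕ.+ 0) ℕ.* 1) ≡ suc b ℕ.* n
    shrink = solve-∀
    bound : ∀ Q n → (1ℚ ℚ.+ ε) ℚ.* ((+ Q) ÷ 1) ℚ.≤ (+ n) ÷ 1 → suc (suc b) ℕ.* Q ℕ.≤ suc b ℕ.* n
    bound Q n h with begin
      (mkℚᵘ (+ 1) 0 ℚᵘ.+ mkℚᵘ (+ suc a) b) ℚᵘ.* mkℚᵘ (+ Q) 0    ≃⟨ ℚᵘ.*-cong (ℚ.toℚᵘ-homo-+ 1ℚ ε) (ℚ.toℚᵘ-fromℚᵘ (mkℚᵘ (+ Q) 0)) ⟨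
      toℚᵘ (1ℚ ℚ.+ ε) ℚᵘ.* toℚᵘ ((+ Q) ÷ 1)                     ≃⟨ ℚ.toℚᵘ-homo-* (1ℚ ℚ.+ ε) ((+ Q) ÷ 1) ⟨
      toℚᵘ ((1ℚ ℚ.+ ε) ℚ.* ((+ Q) ÷ 1))                         ≤⟨ ℚ.toℚᵘ-mono-≤ h ⟩
      toℚᵘ ((+ n) ÷ 1)                                          ≃⟨ ℚ.toℚᵘ-fromℚᵘ (mkℚᵘ (+ n) 0) ⟩
      mkℚᵘ (+ n) 0                                              ∎
    ... | ℚᵘ.*≤* le = ℕ.≤-trans (ℕ.m≤m+n _ (a ℕ.* Q)) (ℕ.≤-trans (ℕ.≤-reflexive (sym (expand Q a b)))
                        (ℕ.≤-trans (ℤ.drop‿+≤+ (subst₂ ℤ._≤_ left right le)) (ℕ.≤-reflexive (shrink n b))))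
      where
      A D : ℕ
      A = 1 ℕ.* suc b ℕ.+ suc a ℕ.* 1
      D = suc ((b ℕ.+ 0) ℕ.* 1)
      left : (+ A ℤ.* + Q) ℤ.* + 1 ≡ + (A ℕ.* Q ℕ.* 1)
      left = trans (cong (ℤ._* + 1) (sym (ℤ.pos-* A Q))) (sym (ℤ.pos-* (A ℕ.* Q) 1))
      right : + n ℤ.* + D ≡ + (n ℕ.* D)
      right = sym (ℤ.pos-* n D)

-- Finite fields: cancellation, roots of quadratics, odd order

module FiniteGeometry {c ℓ : Level} {q : ℕ} (F : FiniteField c ℓ q) where
  open Counting
  open Arithmetic
  open import Data.Nat using (zero; suc; _+_; _*_; _∸_; _^_; _≤_; _<_; _⊓_; z≤n; s≤s; >-nonZero)
  open import Data.Nat.Properties hiding (_≟_)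
  open import Data.Nat.DivMod using (_/_; m*n/n≡m; /-monoˡ-≤; m/n*n≤m)
  open import Data.Nat.Divisibility using (_∣_)
  open import Data.Nat.Tactic.RingSolver using (solve-∀)
  open import Data.List using (List; []; _∷_; _++_; length; map; filter; concatMap; deduplicate; take)
  open import Data.List.Properties using (length-map; length-++; length-take)
  open import Data.List.Membership.Propositional using (_∈_; find; lose)
  open import Data.List.Membership.Propositional.Properties
    using (∈-filter⁺; ∈-filter⁻; ∈-map⁺; ∈-map⁻; ∈-++⁺ʳ; ∈-++⁻; ∈-concatMap⁻; ∈-deduplicate⁻)
  open import Data.List.Relation.Unary.Any as Any using (Any; here)
  import Data.List.Relation.Unary.Any.Properties as Any
  open import Data.List.Relation.Unary.AllPairs using (AllPairs; []; _∷_)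
  import Data.List.Relation.Unary.AllPairs.Properties as AllPairs
  open import Data.Product using (∃; _×_; _,_; proj₁; proj₂)
  open import Data.Sum using (inj₁; inj₂)
  open import Data.Vec as Vec using (Vec; []; _∷_)
  open import Data.Vec.Relation.Binary.Pointwise.Inductive as PW using ([]; _∷_)
  open import Data.Empty using (⊥; ⊥-elim)
  open import Function using (_∘_)
  open import Relation.Nullary using (¬_; Dec; yes; no)
  open import Relation.Nullary.Decidable using (¬?; _×-dec_; decidable-stable)
  open import Relation.Unary using () renaming (Decidable to Decidable₁)
  open import Relation.Binary using () renaming (Decidable to Decidable₂)
  open import Relation.Binary.PropositionalEquality using (_≡_; refl; sym; trans; cong; cong₂; subst; module ≡-Reasoning)
  import Relation.Binary.Reasoning.Setoid as SetoidReasoning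

  open FiniteField F public
    using (Carrier; _≈_; 0#; 1#; 1≉0; _⁻¹; ⁻¹-inverse; elements; elements-complete; elements-distinct; elements-length; commRing; setoid)
    renaming (_+_ to _⊕_; _*_ to _⊗_; _≟_ to infix 4 _≟_; -_ to ⊝_; _-_ to _⊖_; refl to ≈-refl; sym to ≈-sym; trans to ≈-trans;
              +-cong to ⊕-cong; *-cong to ⊗-cong; -‿cong to ⊝-cong; +-congˡ to ⊕-congˡ; +-congʳ to ⊕-congʳ;
              *-congˡ to ⊗-congˡ; *-congʳ to ⊗-congʳ; zeroˡ to ⊗-zeroˡ; zeroʳ to ⊗-zeroʳ; *-comm to ⊗-comm;
              +-identityˡ to ⊕-identityˡ; *-identityˡ to ⊗-identityˡ)
  open IntegerCoefficients commRing public
    using (_:=_; _:+_; _:*_; _:-_; :-_) renaming (solve to ring)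
  module ≈-Reasoning = SetoidReasoning setoid

  ⊖-cong : ∀ {w x y z} → w ≈ x → y ≈ z → w ⊖ y ≈ x ⊖ z
  ⊖-cong p r = ⊕-cong p (⊝-cong r)

  ⊖≈0⇒≈ : ∀ {x y} → x ⊖ y ≈ 0# → x ≈ y
  ⊖≈0⇒≈ {x} {y} h = begin
    x            ≈⟨ ring 2 (λ x y → x := (x :- y) :+ y) ≈-refl x y ⟩
    (x ⊖ y) ⊕ y  ≈⟨ ⊕-congʳ h ⟩
    0# ⊕ y       ≈⟨ ⊕-identityˡ y ⟩
    y            ∎
    where open ≈-Reasoning

  ≈⇒⊖≈0 : ∀ {x y} → x ≈ y → x ⊖ y ≈ 0#
  ≈⇒⊖≈0 {x} {y} h = ≈-trans (⊕-congʳ h) (FiniteField.-‿inverseʳ F y)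

  ⊗-cancel-0 : ∀ {x y} → ¬ x ≈ 0# → x ⊗ y ≈ 0# → y ≈ 0#
  ⊗-cancel-0 {x} {y} x≉0 xy≈0 = begin
    y                ≈⟨ ⊗-identityˡ y ⟨
    1# ⊗ y           ≈⟨ ⊗-congʳ (⁻¹-inverse x x≉0) ⟨
    (x ⊗ (x ⁻¹)) ⊗ y ≈⟨ ring 3 (λ x i y → (x :* i) :* y := i :* (x :* y)) ≈-refl x (x ⁻¹) y ⟩
    (x ⁻¹) ⊗ (x ⊗ y) ≈⟨ ⊗-congˡ xy≈0 ⟩
    (x ⁻¹) ⊗ 0#      ≈⟨ ⊗-zeroʳ _ ⟩
    0#               ∎
    where open ≈-Reasoning

  ⊗-≉0 : ∀ {x y} → ¬ x ≈ 0# → ¬ y ≈ 0# → ¬ x ⊗ y ≈ 0#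
  ⊗-≉0 x≉0 y≉0 = y≉0 ∘ ⊗-cancel-0 x≉0

  ⊗-cancelˡ : ∀ {x y z} → ¬ x ≈ 0# → x ⊗ y ≈ x ⊗ z → y ≈ z
  ⊗-cancelˡ {x} {y} {z} x≉0 h = ⊖≈0⇒≈ (⊗-cancel-0 x≉0
    (≈-trans (ring 3 (λ x y z → x :* (y :- z) := x :* y :- x :* z) ≈-refl x y z) (≈⇒⊖≈0 h)))

  elements-≤1 : ∀ {p} {P : Carrier → Set p} (P? : Decidable₁ P) →
                (∀ {x y} → P x → P y → x ≈ y) → ∑ elements (𝟙 ∘ P?) ≤ 1
  elements-≤1 P? unique = AllPairs⇒∑≤1 P? elements-distinct (λ x≉y Px Py → x≉y (unique Px Py))

  ∑≟≡1 : ∀ x → ∑ elements (λ t → 𝟙 (x ≟ t)) ≡ 1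
  ∑≟≡1 x = ≤-antisym (elements-≤1 (x ≟_) (λ p r → ≈-trans (≈-sym p) r)) (Any⇒1≤∑ (x ≟_) (elements-complete x))

  -- Given one root `s`, the polynomial equals its value at `s` plus `t ⊖ s` times a linear
  -- cofactor, so every other root is the single root of that cofactor.
  quadratic-roots-≤2 : ∀ {p} {P : Carrier → Set p} (P? : Decidable₁ P) a b e → ¬ a ≈ 0# →
                       (∀ {t} → P t → ((a ⊗ (t ⊗ t)) ⊕ (b ⊗ t)) ⊕ e ≈ 0#) → ∑ elements (𝟙 ∘ P?) ≤ 2
  quadratic-roots-≤2 P? a b e a≉0 root with Any.any? P? elements
  ... | no none = ≤-trans (≤-reflexive (∑≡0 P? elements (λ t∈ → none ∘ lose t∈))) z≤n
  ... | yes some with find some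
  ...   | s , _ , Ps = begin
    ∑ elements (𝟙 ∘ P?)
      ≤⟨ ∑-mono elements (λ t → 𝟙≤ (P? t) (covered t)) ⟩
    ∑ elements (λ t → 𝟙 (t ≟ s) + 𝟙 (cofactor t ≟ 0#))
      ≡⟨ ∑-+ elements _ _ ⟩
    ∑ elements (λ t → 𝟙 (t ≟ s)) + ∑ elements (λ t → 𝟙 (cofactor t ≟ 0#))
      ≤⟨ +-mono-≤ (elements-≤1 (_≟ s) (λ p r → ≈-trans p (≈-sym r)))
                  (elements-≤1 (λ t → cofactor t ≟ 0#) cofactor-injective) ⟩
    2 ∎
    where
    open ≤-Reasoning
    cofactor : Carrier → Carrier
    cofactor t = (a ⊗ (t ⊕ s)) ⊕ b
    cofactor-injective : ∀ {t u} → cofactor t ≈ 0# → cofactor u ≈ 0# → t ≈ u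
    cofactor-injective {t} {u} p r = ⊖≈0⇒≈ (⊗-cancel-0 a≉0 (≈-trans
      (ring 5 (λ a b s t u → a :* (t :- u) := ((a :* (t :+ s)) :+ b) :- ((a :* (u :+ s)) :+ b)) ≈-refl a b s t u)
      (≈⇒⊖≈0 (≈-trans p (≈-sym r)))))
    covered : ∀ t → _ → 1 ≤ 𝟙 (t ≟ s) + 𝟙 (cofactor t ≟ 0#)
    covered t Pt with t ≟ s
    ... | yes _ = s≤s z≤n
    ... | no t≉s = 1≤𝟙 (cofactor t ≟ 0#) (⊗-cancel-0 (t≉s ∘ ⊖≈0⇒≈) (≈-trans
      (ring 5 (λ a b e s t → (t :- s) :* ((a :* (t :+ s)) :+ b)
         := (((a :* (t :* t)) :+ (b :* t)) :+ e) :- (((a :* (s :* s)) :+ (b :* s)) :+ e)) ≈-refl a b e s t)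
      (≈⇒⊖≈0 (≈-trans (root Pt) (≈-sym (root Ps))))))

  nonzeros : List Carrier
  nonzeros = filter (λ x → ¬? (x ≟ 0#)) elements

  q≡1+nonzeros : q ≡ suc (length nonzeros)
  q≡1+nonzeros = begin
    q                                                        ≡⟨ elements-length ⟨
    length elements                                          ≡⟨ ∑-1 elements ⟨
    ∑ elements (λ _ → 1)                                     ≡⟨ ∑-cong elements (λ x → 𝟙+𝟙¬ (x ≟ 0#)) ⟨
    ∑ elements (λ x → 𝟙 (x ≟ 0#) + 𝟙 (¬? (x ≟ 0#)))          ≡⟨ ∑-+ elements _ _ ⟩
    ∑ elements (λ x → 𝟙 (x ≟ 0#)) + ∑ elements (λ x → 𝟙 (¬? (x ≟ 0#)))
      ≡⟨ cong₂ _+_ (trans (∑-cong elements (λ x → 𝟙-cong (x ≟ 0#) (0# ≟ x) ≈-sym ≈-sym)) (∑≟≡1 0#))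
                   (sym (length-filter _ elements)) ⟩
    suc (length nonzeros)                                    ∎
    where open ≡-Reasoning

  filter-complete : ∀ {p} {P : Carrier → Set p} (P? : Decidable₁ P) → (∀ {x y} → x ≈ y → P x → P y) →
                    ∀ {x} → P x → Any (x ≈_) (filter P? elements)
  filter-complete P? resp {x} Px with Any.filter⁺ P? (elements-complete x)
  ... | inj₁ x∈ = x∈
  ... | inj₂ ¬P = ⊥-elim (¬P (resp (Any.lookup-result (elements-complete x)) Px))

  nonzeros-complete : ∀ {x} → ¬ x ≈ 0# → Any (x ≈_) nonzeros
  nonzeros-complete = filter-complete _ (λ x≈y x≉0 → x≉0 ∘ ≈-trans x≈y)

  ∈-nonzeros⇒≉0 : ∀ {x} → x ∈ nonzeros → ¬ x ≈ 0#
  ∈-nonzeros⇒≉0 x∈ = proj₂ (∈-filter⁻ (λ x → ¬? (x ≟ 0#)) {xs = elements} x∈)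

  0<nonzeros : 0 < length nonzeros
  0<nonzeros with nonzeros | nonzeros-complete 1≉0
  ... | _ ∷ _ | _ = s≤s z≤n

  -- If 2 were 0, then adding 1 would be an involution without fixed points, and its pairs would
  -- make `q` even.
  odd⇒2≉0 : ¬ (2 ∣ q) → ¬ 1# ⊕ 1# ≈ 0#
  odd⇒2≉0 odd 2≈0 = odd (subst (2 ∣_) total (handshake (λ x y → (x ⊕ 1#) ≟ y) swap fixed-point-free elements))
    where
    open ≈-Reasoning
    swap : ∀ {x y} → x ⊕ 1# ≈ y → y ⊕ 1# ≈ x
    swap {x} {y} h = begin
      y ⊕ 1#          ≈⟨ ⊕-congʳ h ⟨
      (x ⊕ 1#) ⊕ 1#   ≈⟨ FiniteField.+-assoc F x 1# 1# ⟩
      x ⊕ (1# ⊕ 1#)   ≈⟨ ⊕-congˡ 2≈0 ⟩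
      x ⊕ 0#          ≈⟨ FiniteField.+-identityʳ F x ⟩
      x               ∎
    fixed-point-free : ∀ {x} → ¬ x ⊕ 1# ≈ x
    fixed-point-free {x} h = 1≉0 (begin
      1#              ≈⟨ ring 2 (λ x o → o := (x :+ o) :- x) ≈-refl x 1# ⟩
      (x ⊕ 1#) ⊖ x    ≈⟨ ≈⇒⊖≈0 h ⟩
      0#              ∎)
    total : ∑ elements (λ x → ∑ elements (λ y → 𝟙 ((x ⊕ 1#) ≟ y))) ≡ q
    total = trans (∑-cong elements (λ x → ∑≟≡1 (x ⊕ 1#))) (trans (∑-1 elements) elements-length)

  -- Vectors and the scalar product

  private
    variable
      d k : ℕ

  open Geometry F public using (Point; ‖_‖)
    renaming (_·_ to infix 8 _·_; _-ᵥ_ to infixl 6 _-ᵥ_; _≋_ to infix 4 _≋_; _≋?_ to infix 4 _≋?_)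

  ≋-refl : {u : Point d} → u ≋ u
  ≋-refl = PW.refl ≈-refl

  ≋-sym : {u v : Point d} → u ≋ v → v ≋ u
  ≋-sym = PW.sym ≈-sym

  ≋-trans : {u v w : Point d} → u ≋ v → v ≋ w → u ≋ w
  ≋-trans = PW.trans ≈-trans

  -ᵥ-cong : {u u′ v v′ : Point d} → u ≋ u′ → v ≋ v′ → (u -ᵥ v) ≋ (u′ -ᵥ v′)
  -ᵥ-cong [] [] = []
  -ᵥ-cong (p ∷ ps) (r ∷ rs) = ⊖-cong p r ∷ -ᵥ-cong ps rs

  ·-cong : {u u′ v v′ : Point d} → u ≋ u′ → v ≋ v′ → u · v ≈ u′ · v′
  ·-cong [] [] = ≈-refl
  ·-cong (p ∷ ps) (r ∷ rs) = ⊕-cong (⊗-cong p r) (·-cong ps rs)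

  ‖‖-cong : {u v : Point d} → u ≋ v → ‖ u ‖ ≈ ‖ v ‖
  ‖‖-cong p = ·-cong p p

  ·-comm : (u v : Point d) → u · v ≈ v · u
  ·-comm [] [] = ≈-refl
  ·-comm (x ∷ u) (y ∷ v) = ⊕-cong (⊗-comm x y) (·-comm u v)

  -ᵥ-· : (u v w : Point d) → (u -ᵥ v) · w ≈ u · w ⊖ v · w
  -ᵥ-· [] [] [] = ≈-sym (≈⇒⊖≈0 ≈-refl)
  -ᵥ-· (x ∷ u) (y ∷ v) (z ∷ w) = ≈-trans (⊕-congˡ (-ᵥ-· u v w))
    (ring 5 (λ x y z a b → (x :- y) :* z :+ (a :- b) := (x :* z :+ a) :- (y :* z :+ b)) ≈-refl x y z (u · w) (v · w))

  ·--ᵥ : (w u v : Point d) → w · (u -ᵥ v) ≈ w · u ⊖ w · v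
  ·--ᵥ w u v = ≈-trans (·-comm w (u -ᵥ v)) (≈-trans (-ᵥ-· u v w) (⊖-cong (·-comm u w) (·-comm v w)))

  infixr 9 _∗_
  _∗_ : Carrier → Point d → Point d
  t ∗ u = Vec.map (t ⊗_) u

  ∗-· : ∀ t (u v : Point d) → t ∗ u · v ≈ t ⊗ u · v
  ∗-· t [] [] = ≈-sym (⊗-zeroʳ t)
  ∗-· t (x ∷ u) (y ∷ v) = ≈-trans (⊕-congˡ (∗-· t u v))
    (ring 4 (λ t x y a → (t :* x) :* y :+ t :* a := t :* (x :* y :+ a)) ≈-refl t x y (u · v))

  ·-∗ : ∀ t (u v : Point d) → u · (t ∗ v) ≈ t ⊗ u · v
  ·-∗ t u v = ≈-trans (·-comm u (t ∗ v)) (≈-trans (∗-· t v u) (⊗-congˡ (·-comm v u)))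

  ‖∗‖ : ∀ t (u : Point d) → ‖ t ∗ u ‖ ≈ t ⊗ (t ⊗ ‖ u ‖)
  ‖∗‖ t u = ≈-trans (∗-· t u (t ∗ u)) (⊗-congˡ (·-∗ t u u))

  ∗-cong : ∀ {s t} {u v : Point d} → s ≈ t → u ≋ v → (s ∗ u) ≋ (t ∗ v)
  ∗-cong p [] = []
  ∗-cong p (r ∷ rs) = ⊗-cong p r ∷ ∗-cong p rs

  ∗-∗ : ∀ s t (u : Point d) → s ∗ t ∗ u ≋ ((s ⊗ t) ∗ u)
  ∗-∗ s t [] = []
  ∗-∗ s t (x ∷ u) = ≈-sym (FiniteField.*-assoc F s t x) ∷ ∗-∗ s t u

  1∗ : (u : Point d) → 1# ∗ u ≋ u
  1∗ [] = []
  1∗ (x ∷ u) = ⊗-identityˡ x ∷ 1∗ u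

  ‖-ᵥ‖ : (u v : Point d) → ‖ u -ᵥ v ‖ ≈ (‖ u ‖ ⊖ (u · v ⊕ u · v)) ⊕ ‖ v ‖
  ‖-ᵥ‖ u v = begin
    ‖ u -ᵥ v ‖                                  ≈⟨ -ᵥ-· u v (u -ᵥ v) ⟩
    u · (u -ᵥ v) ⊖ v · (u -ᵥ v)                 ≈⟨ ⊖-cong (·--ᵥ u u v) (·--ᵥ v u v) ⟩
    (‖ u ‖ ⊖ u · v) ⊖ (v · u ⊖ ‖ v ‖)           ≈⟨ ⊖-cong ≈-refl (⊖-cong (·-comm v u) ≈-refl) ⟩
    (‖ u ‖ ⊖ u · v) ⊖ (u · v ⊖ ‖ v ‖)           ≈⟨ ring 3 (λ a b e → (a :- b) :- (b :- e) := (a :- (b :+ b)) :+ e) ≈-refl _ _ _ ⟩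
    (‖ u ‖ ⊖ (u · v ⊕ u · v)) ⊕ ‖ v ‖           ∎
    where open ≈-Reasoning

  0ᵥ : Point d
  0ᵥ = Vec.replicate _ 0#

  ·-0ᵥ : (u : Point d) → u · 0ᵥ ≈ 0#
  ·-0ᵥ [] = ≈-refl
  ·-0ᵥ (x ∷ u) = ≈-trans (⊕-cong (⊗-zeroʳ x) (·-0ᵥ u)) (⊕-identityˡ 0#)

  anisotropic⇒≉0ᵥ : {u : Point d} → ¬ ‖ u ‖ ≈ 0# → ¬ u ≋ 0ᵥ
  anisotropic⇒≉0ᵥ {d} ‖u‖≉0 u≋0 = ‖u‖≉0 (≈-trans (‖‖-cong u≋0) (·-0ᵥ {d} 0ᵥ))

  -ᵥ≋0ᵥ⇒≋ : {u v : Point d} → (u -ᵥ v) ≋ 0ᵥ → u ≋ v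
  -ᵥ≋0ᵥ⇒≋ {u = []} {[]} [] = []
  -ᵥ≋0ᵥ⇒≋ {u = _ ∷ _} {_ ∷ _} (p ∷ ps) = ⊖≈0⇒≈ p ∷ -ᵥ≋0ᵥ⇒≋ ps

  ≋⇒-ᵥ≋0ᵥ : {u v : Point d} → u ≋ v → (u -ᵥ v) ≋ 0ᵥ
  ≋⇒-ᵥ≋0ᵥ [] = []
  ≋⇒-ᵥ≋0ᵥ (p ∷ ps) = ≈⇒⊖≈0 p ∷ ≋⇒-ᵥ≋0ᵥ ps

  -ᵥ-translate : (x y a : Point d) → ((x -ᵥ a) -ᵥ (y -ᵥ a)) ≋ (x -ᵥ y)
  -ᵥ-translate [] [] [] = []
  -ᵥ-translate (x ∷ xs) (y ∷ ys) (a ∷ as) =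
    ring 3 (λ x y a → (x :- a) :- (y :- a) := x :- y) ≈-refl x y a ∷ -ᵥ-translate xs ys as

  -ᵥ-injectiveˡ : {x y : Point d} (a : Point d) → (x -ᵥ a) ≋ (y -ᵥ a) → x ≋ y
  -ᵥ-injectiveˡ {x = x} {y} a h = -ᵥ≋0ᵥ⇒≋ (≋-trans (≋-sym (-ᵥ-translate x y a)) (≋⇒-ᵥ≋0ᵥ h))

  -- Parallel vectors

  -- u ∥ v says that v is a multiple of u, so it is symmetric only away from 0.
  _∥_ : Point d → Point d → Set _
  u ∥ v = Any (λ t → v ≋ (t ∗ u)) elements

  _∥?_ : Decidable₂ (_∥_ {d})
  u ∥? v = Any.any? (λ t → v ≋? (t ∗ u)) elements

  ∥-intro : ∀ {t} {u v : Point d} → v ≋ (t ∗ u) → u ∥ v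
  ∥-intro h = Any.map (λ t≈s → ≋-trans h (∗-cong t≈s ≋-refl)) (elements-complete _)

  ∥-elim : {u v : Point d} → u ∥ v → ∃ λ t → v ≋ (t ∗ u)
  ∥-elim h with find h
  ... | t , _ , v≋tu = t , v≋tu

  ∥-refl : {u : Point d} → u ∥ u
  ∥-refl {u = u} = ∥-intro (≋-sym (1∗ u))

  ∥-trans : {u v w : Point d} → u ∥ v → v ∥ w → u ∥ w
  ∥-trans {u = u} h k with ∥-elim h | ∥-elim k
  ... | s , v≋su | t , w≋tv = ∥-intro (≋-trans w≋tv (≋-trans (∗-cong ≈-refl v≋su) (∗-∗ t s u)))

  multiples-∥ : ∀ {s t} {u v : Point d} → ¬ t ≈ 0# → (s ∗ u) ≋ (t ∗ v) → u ∥ v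
  multiples-∥ {s = s} {t} {u} {v} t≉0 h = ∥-intro (≋-trans (≋-sym (1∗ v))
    (≋-trans (∗-cong (≈-sym (≈-trans (⊗-comm _ _) (⁻¹-inverse t t≉0))) ≋-refl)
    (≋-trans (≋-sym (∗-∗ (t ⁻¹) t v)) (≋-trans (∗-cong ≈-refl (≋-sym h)) (∗-∗ (t ⁻¹) s u)))))

  -- Enumeration of the space and size of hyperplanes

  points : ∀ d → List (Point d)
  points zero = [] ∷ []
  points (suc d) = concatMap (λ x → map (x ∷_) (points d)) elements

  ∑-points : ∀ d (f : Point (suc d) → ℕ) →
             ∑ (points (suc d)) f ≡ ∑ elements (λ x → ∑ (points d) (λ u → f (x ∷ u)))
  ∑-points d f = trans (∑-concatMap _ elements f) (∑-cong elements (λ x → ∑-map (x ∷_) (points d) f))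

  length-points : ∀ d → length (points d) ≡ q ^ d
  length-points zero = refl
  length-points (suc d) = begin
    length (points (suc d))                      ≡⟨ ∑-1 (points (suc d)) ⟨
    ∑ (points (suc d)) (λ _ → 1)                 ≡⟨ ∑-points d _ ⟩
    ∑ elements (λ _ → ∑ (points d) (λ _ → 1))    ≡⟨ ∑-const elements _ ⟩
    length elements * ∑ (points d) (λ _ → 1)     ≡⟨ cong₂ _*_ elements-length (trans (∑-1 (points d)) (length-points d)) ⟩
    q * q ^ d                                    ∎
    where open ≡-Reasoning

  points-complete : (u : Point d) → Any (u ≋_) (points d)
  points-complete [] = here []
  points-complete (x ∷ u) = Any.concatMap⁺ _ (Any.map
    (λ x≈y → Any.map⁺ (Any.map (x≈y ∷_) (points-complete u))) (elements-complete x))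

  -- If the first coordinate of the normal vector is nonzero, the remaining coordinates of a
  -- solution determine its first one. If it is zero, the first coordinate of a solution is free,
  -- and induction applies to the rest.
  hyperplane : (v : Point d) → ¬ v ≋ 0ᵥ → q * ∑ (points d) (λ x → 𝟙 (x · v ≟ 0#)) ≤ q ^ d
  hyperplane [] v≉0 = ⊥-elim (v≉0 [])
  hyperplane {suc d} (y ∷ v) yv≉0 with y ≟ 0#
  ... | yes y≈0 = *-monoʳ-≤ q (begin
    ∑ (points (suc d)) (λ x → 𝟙 (x · (y ∷ v) ≟ 0#))
      ≡⟨ ∑-points d _ ⟩
    ∑ elements (λ x → ∑ (points d) (λ u → 𝟙 ((x ⊗ y ⊕ u · v) ≟ 0#)))
      ≤⟨ ∑-mono elements (λ x → ∑-mono (points d) (λ u → 𝟙-mono _ (u · v ≟ 0#) (drop x u))) ⟩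
    ∑ elements (λ _ → ∑ (points d) (λ u → 𝟙 (u · v ≟ 0#)))
      ≡⟨ trans (∑-const elements _) (cong (_* ∑ (points d) (λ u → 𝟙 (u · v ≟ 0#))) elements-length) ⟩
    q * ∑ (points d) (λ u → 𝟙 (u · v ≟ 0#))
      ≤⟨ hyperplane v (λ v≋0 → yv≉0 (y≈0 ∷ v≋0)) ⟩
    q ^ d ∎)
    where
    open ≤-Reasoning
    drop : ∀ x u → x ⊗ y ⊕ u · v ≈ 0# → u · v ≈ 0#
    drop x u h = ≈-trans (≈-sym (≈-trans (⊕-congʳ (≈-trans (⊗-congˡ y≈0) (⊗-zeroʳ x))) (⊕-identityˡ _))) h
  ... | no y≉0 = *-monoʳ-≤ q (begin
    ∑ (points (suc d)) (λ x → 𝟙 (x · (y ∷ v) ≟ 0#))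
      ≡⟨ ∑-points d _ ⟩
    ∑ elements (λ x → ∑ (points d) (λ u → 𝟙 ((x ⊗ y ⊕ u · v) ≟ 0#)))
      ≡⟨ ∑-swap elements (points d) _ ⟩
    ∑ (points d) (λ u → ∑ elements (λ x → 𝟙 ((x ⊗ y ⊕ u · v) ≟ 0#)))
      ≤⟨ ∑-mono (points d) (λ u → elements-≤1 _ (solution-unique u)) ⟩
    ∑ (points d) (λ _ → 1)
      ≡⟨ trans (∑-1 (points d)) (length-points d) ⟩
    q ^ d ∎)
    where
    open ≤-Reasoning
    solution-unique : ∀ u {s t} → s ⊗ y ⊕ u · v ≈ 0# → t ⊗ y ⊕ u · v ≈ 0# → s ≈ t
    solution-unique u {s} {t} p r = ⊖≈0⇒≈ (⊗-cancel-0 y≉0 (≈-trans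
      (ring 4 (λ s t y e → y :* (s :- t) := (s :* y :+ e) :- (t :* y :+ e)) ≈-refl s t y (u · v))
      (≈⇒⊖≈0 (≈-trans p (≈-sym r)))))

  -- Energy and its variance estimate

  Distinct : List (Point d) → Set _
  Distinct xs = ∀ u → ∑ xs (λ x → 𝟙 (x ≋? u)) ≤ 1

  filter-Distinct : ∀ {p} {P : Point d → Set p} (P? : Decidable₁ P) {xs : List (Point d)} →
                    Distinct xs → Distinct (filter P? xs)
  filter-Distinct P? {xs} dist u = ≤-trans (∑-filter-≤ P? xs _) (dist u)

  energy : List (Point d) → Point d → ℕ
  energy Y x = ∑ Y (λ y → ∑ Y (λ z → 𝟙 (x · y ≟ x · z)))

  -- `collisions`, with the `q` possible values of `x · y` as labels.
  energy-lower-bound : (Y : List (Point d)) (x : Point d) → length Y * length Y ≤ q * energy Y x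
  energy-lower-bound Y x = subst (λ n → length Y * length Y ≤ n * energy Y x) elements-length
    (collisions (λ y t → x · y ≟ t) (λ y z → x · y ≟ x · z) Y elements
      (λ _ → elements-complete _) (λ y → ≤-reflexive (∑≟≡1 (x · y))) (λ p r → ≈-trans p (≈-sym r)))

  energy-mono : (Y : List (Point d)) {x x′ : Point d} →
                (∀ {y z} → x · y ≈ x · z → x′ · y ≈ x′ · z) → energy Y x ≤ energy Y x′
  energy-mono Y h = ∑-mono Y (λ y → ∑-mono Y (λ z → 𝟙-mono _ _ h))

  -- For `y ≠ z` the vectors `x` with `x · y ≈ x · z` form a hyperplane. A diagonal pair is counted
  -- for every `x`, which after the factor `q` is q - 1 times q^d more than a hyperplane accounts
  -- for.
  energy-total : (Y : List (Point d)) → Distinct Y →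
                 ∑ (points d) (λ x → q * energy Y x) ≤ length Y * (length Y * q ^ d + length nonzeros * q ^ d)
  energy-total {d} Y dist = begin
    ∑ (points d) (λ x → q * energy Y x)
      ≡⟨ ∑-*ˡ (points d) q _ ⟩
    q * ∑ (points d) (energy Y)
      ≡⟨ cong (q *_) (trans (∑-swap (points d) Y _) (∑-cong Y (λ y → ∑-swap (points d) Y _))) ⟩
    q * ∑ Y (λ y → ∑ Y (λ z → ∑ (points d) (λ x → 𝟙 (x · y ≟ x · z))))
      ≡⟨ trans (sym (∑-*ˡ Y q _)) (∑-cong Y (λ y → sym (∑-*ˡ Y q _))) ⟩
    ∑ Y (λ y → ∑ Y (λ z → q * ∑ (points d) (λ x → 𝟙 (x · y ≟ x · z))))
      ≤⟨ ∑-mono Y (λ y → ∑-mono Y (pair y)) ⟩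
    ∑ Y (λ y → ∑ Y (λ z → q ^ d + 𝟙 (z ≋? y) * (n * q ^ d)))
      ≡⟨ ∑-cong Y (λ y → trans (∑-+ Y _ _) (cong₂ _+_ (∑-const Y _) (∑-*ʳ Y (n * q ^ d) _))) ⟩
    ∑ Y (λ y → length Y * q ^ d + ∑ Y (λ z → 𝟙 (z ≋? y)) * (n * q ^ d))
      ≤⟨ ∑-mono Y (λ y → +-monoʳ-≤ (length Y * q ^ d) (≤-trans (*-monoˡ-≤ (n * q ^ d) (dist y)) (≤-reflexive (*-identityˡ (n * q ^ d))))) ⟩
    ∑ Y (λ y → length Y * q ^ d + n * q ^ d)
      ≡⟨ ∑-const Y _ ⟩
    length Y * (length Y * q ^ d + n * q ^ d) ∎
    where
    open ≤-Reasoning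
    n : ℕ
    n = length nonzeros
    pair : ∀ y z → q * ∑ (points d) (λ x → 𝟙 (x · y ≟ x · z)) ≤ q ^ d + 𝟙 (z ≋? y) * (n * q ^ d)
    pair y z with z ≋? y
    ... | yes _ = begin
      q * ∑ (points d) (λ x → 𝟙 (x · y ≟ x · z)) ≤⟨ *-monoʳ-≤ q (∑-mono (points d) (λ x → 𝟙≤ (x · y ≟ x · z) (λ _ → ≤-refl))) ⟩
      q * ∑ (points d) (λ _ → 1)                 ≡⟨ cong (q *_) (trans (∑-1 (points d)) (length-points d)) ⟩
      q * q ^ d                                  ≡⟨ cong (_* q ^ d) q≡1+nonzeros ⟩
      q ^ d + n * q ^ d                          ≡⟨ cong (q ^ d +_) (+-identityʳ _) ⟨
      q ^ d + 1 * (n * q ^ d)                    ∎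
    ... | no z≉y = begin
      q * ∑ (points d) (λ x → 𝟙 (x · y ≟ x · z))
        ≤⟨ *-monoʳ-≤ q (∑-mono (points d) (λ x → 𝟙-mono (x · y ≟ x · z) (x · (z -ᵥ y) ≟ 0#)
             (λ xy≈xz → ≈-trans (·--ᵥ x z y) (≈⇒⊖≈0 (≈-sym xy≈xz))))) ⟩
      q * ∑ (points d) (λ x → 𝟙 (x · (z -ᵥ y) ≟ 0#))
        ≤⟨ hyperplane (z -ᵥ y) (z≉y ∘ -ᵥ≋0ᵥ⇒≋) ⟩
      q ^ d
        ≡⟨ +-identityʳ _ ⟨
      q ^ d + 0 ∎

  -- This is `q` times the sum of the squared deviations of the counts of the values `x · y` from
  -- their mean |Y|/q. The truncated subtraction is exact by `energy-lower-bound`.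
  excess : List (Point d) → Point d → ℕ
  excess Y x = q * energy Y x ∸ length Y * length Y

  q*energy≡ : (Y : List (Point d)) (x : Point d) → excess Y x + length Y * length Y ≡ q * energy Y x
  q*energy≡ Y x = m∸n+n≡m (energy-lower-bound Y x)

  -- Serves both for `≋`-equal vectors and for passing from a vector to its multiples.
  excess-mono : (Y : List (Point d)) (x x′ : Point d) →
                (∀ {y z} → x · y ≈ x · z → x′ · y ≈ x′ · z) → excess Y x ≤ excess Y x′
  excess-mono Y x x′ h = ∸-monoˡ-≤ (length Y * length Y) (*-monoʳ-≤ q (energy-mono Y {x} {x′} h))

  -- The main term of `energy-total` cancels against the subtracted minima; only the diagonal
  -- surplus remains.
  excess-total : (Y : List (Point d)) → Distinct Y →
                 ∑ (points d) (excess Y) ≤ length Y * (length nonzeros * q ^ d)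
  excess-total {d} Y dist = +-cancelʳ-≤ (q ^ d * (y * y)) _ _ (begin
    ∑ (points d) (excess Y) + q ^ d * (y * y)
      ≡⟨ cong (∑ (points d) (excess Y) +_) (trans (∑-const (points d) _) (cong (_* (y * y)) (length-points d))) ⟨
    ∑ (points d) (excess Y) + ∑ (points d) (λ _ → y * y)
      ≡⟨ ∑-+ (points d) _ _ ⟨
    ∑ (points d) (λ x → excess Y x + y * y)
      ≡⟨ ∑-cong (points d) (q*energy≡ Y) ⟩
    ∑ (points d) (λ x → q * energy Y x)
      ≤⟨ energy-total Y dist ⟩
    y * (y * q ^ d + length nonzeros * q ^ d)
      ≡⟨ expand y (q ^ d) (length nonzeros * q ^ d) ⟩
    y * (length nonzeros * q ^ d) + q ^ d * (y * y) ∎)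
    where
    open ≤-Reasoning
    y : ℕ
    y = length Y
    expand : ∀ y s r → y * (y * s + r) ≡ y * r + s * (y * y)
    expand = solve-∀

  -- The excess is never negative, so a sum over part of the space is at most the sum over all of
  -- it.
  excess-Distinct : (X Y : List (Point d)) → Distinct X → Distinct Y →
                    ∑ X (excess Y) ≤ length Y * (length nonzeros * q ^ d)
  excess-Distinct {d} X Y distX distY = ≤-trans
    (∑-inject _≋?_ X (points d) (λ _ → points-complete _) distX
      (λ {x} {x′} x≋x′ → excess-mono Y x x′ (λ h → ≈-trans (·-cong (≋-sym x≋x′) ≋-refl) (≈-trans h (·-cong x≋x′ ≋-refl)))))
    (excess-total Y distY)

  -- Directions and the lines that they span

  Nonparallel : List (Point d) → Set _
  Nonparallel = AllPairs (λ u v → ¬ u ∥ v)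

  Anisotropic : List (Point d) → Set _
  Anisotropic D = ∀ {u} → u ∈ D → ¬ ‖ u ‖ ≈ 0#

  cone : List (Point d) → List (Point d)
  cone D = concatMap (λ w → map (_∗ w) nonzeros) D

  ∑-cone : (D : List (Point d)) (f : Point d → ℕ) → ∑ (cone D) f ≡ ∑ D (λ w → ∑ nonzeros (λ t → f (t ∗ w)))
  ∑-cone D f = trans (∑-concatMap _ D f) (∑-cong D (λ w → ∑-map (_∗ w) nonzeros f))

  ∈-cone⁻ : {D : List (Point d)} {y : Point d} → y ∈ cone D →
            ∃ λ w → ∃ λ t → w ∈ D × (¬ t ≈ 0#) × y ≡ t ∗ w
  ∈-cone⁻ {D = D} y∈ with find (∈-concatMap⁻ (λ w → map (_∗ w) nonzeros) {xs = D} y∈)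
  ... | w , w∈D , y∈w with ∈-map⁻ (_∗ w) y∈w
  ...   | t , t∈ , y≡ = w , t , w∈D , ∈-nonzeros⇒≉0 t∈ , y≡

  -- Nonparallel vectors span lines that meet only in 0, and on the line of `w` the multiplier is
  -- recovered from the product with `w`, as `‖ w ‖` is nonzero.
  cone-Distinct : {D : List (Point d)} → Nonparallel D → Anisotropic D → Distinct (cone D)
  cone-Distinct {D = D} nonparallel anisotropic u = begin
    ∑ (cone D) (λ y → 𝟙 (y ≋? u))                       ≡⟨ ∑-cone D _ ⟩
    ∑ D (λ w → ∑ nonzeros (λ t → 𝟙 (t ∗ w ≋? u)))       ≤⟨ ∑-mono-∈ D once ⟩
    ∑ D (λ w → 𝟙 (hits? w))                             ≤⟨ AllPairs⇒∑≤1 hits? nonparallel separated ⟩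
    1                                                   ∎
    where
    open ≤-Reasoning
    Hits : _ → Set _
    Hits w = Any (λ t → t ∗ w ≋ u) nonzeros
    hits? : ∀ w → Dec (Hits w)
    hits? w = Any.any? (λ t → t ∗ w ≋? u) nonzeros
    once : ∀ {w} → w ∈ D → ∑ nonzeros (λ t → 𝟙 (t ∗ w ≋? u)) ≤ 𝟙 (hits? w)
    once {w} w∈ with hits? w
    ... | no misses = ≤-reflexive (∑≡0 (λ t → t ∗ w ≋? u) nonzeros (λ t∈ h → misses (lose t∈ h)))
    ... | yes _ = AllPairs⇒∑≤1 (λ t → t ∗ w ≋? u) (AllPairs.filter⁺ _ elements-distinct)
      (λ {s} {t} s≉t sw≋u tw≋u → s≉t (⊗-cancelˡ (anisotropic w∈) (≈-trans (⊗-comm _ s) (≈-trans (≈-sym (∗-· s w w))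
        (≈-trans (·-cong (≋-trans sw≋u (≋-sym tw≋u)) ≋-refl) (≈-trans (∗-· t w w) (⊗-comm t _)))))))
    separated : ∀ {v w} → ¬ v ∥ w → Hits v → Hits w → ⊥
    separated v∦w hv hw with find hv | find hw
    ... | s , _ , sv≋u | t , t∈ , tw≋u = v∦w (multiples-∥ (∈-nonzeros⇒≉0 t∈) (≋-trans sv≋u (≋-sym tw≋u)))

  -- Scaling w does not decrease its excess, so summing over the cone gains a factor q - 1.
  excess-directions : (D Y : List (Point d)) → Nonparallel D → Anisotropic D → Distinct Y →
                      ∑ D (excess Y) ≤ length Y * q ^ d
  excess-directions {d} D Y nonparallel anisotropic distY = *-cancelˡ-≤ n {{>-nonZero 0<nonzeros}} (begin
    n * ∑ D (excess Y)                                   ≡⟨ ∑-*ˡ D n _ ⟨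
    ∑ D (λ w → n * excess Y w)                           ≡⟨ ∑-cong D (λ w → ∑-const nonzeros (excess Y w)) ⟨
    ∑ D (λ w → ∑ nonzeros (λ _ → excess Y w))            ≤⟨ ∑-mono D (λ w → ∑-mono nonzeros (λ t → excess-mono Y w (t ∗ w) (scale w t))) ⟩
    ∑ D (λ w → ∑ nonzeros (λ t → excess Y (t ∗ w)))      ≡⟨ ∑-cone D (excess Y) ⟨
    ∑ (cone D) (excess Y)                                ≤⟨ excess-Distinct (cone D) Y (cone-Distinct nonparallel anisotropic) distY ⟩
    length Y * (n * q ^ d)                               ≡⟨ exchange (length Y) n (q ^ d) ⟩
    n * (length Y * q ^ d)                               ∎)
    where
    open ≤-Reasoning
    n : ℕ
    n = length nonzeros
    exchange : ∀ a b e → a * (b * e) ≡ b * (a * e)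
    exchange = solve-∀
    scale : ∀ w t {y z} → w · y ≈ w · z → (t ∗ w) · y ≈ (t ∗ w) · z
    scale w t {y} {z} h = ≈-trans (∗-· t w y) (≈-trans (⊗-congˡ h) (≈-sym (∗-· t w z)))

  -- Spreads between many directions

  spread : Point d → Point d → Carrier
  spread u v = 1# ⊖ ((u · v) ⊗ (u · v)) ⊗ ((‖ u ‖ ⊗ ‖ v ‖) ⁻¹)

  -- Once the multiple of `u` has a prescribed norm `g`, its product with `w` is determined up to
  -- sign by the spread: the scaling factor enters the squared product and the norm in the same way.
  spread-∗ : ∀ {w u : Point d} {t g s} → ¬ ‖ w ‖ ≈ 0# → ¬ ‖ u ‖ ≈ 0# → ‖ t ∗ u ‖ ≈ g → spread w u ≈ s →
             w · (t ∗ u) ⊗ w · (t ∗ u) ≈ (1# ⊖ s) ⊗ (‖ w ‖ ⊗ g)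
  spread-∗ {w = w} {u} {t} {g} {s} ‖w‖≉0 ‖u‖≉0 ‖tu‖≈g spread≈s = begin
    w · (t ∗ u) ⊗ w · (t ∗ u)
      ≈⟨ ⊗-cong (·-∗ t w u) (·-∗ t w u) ⟩
    (t ⊗ w · u) ⊗ (t ⊗ w · u)
      ≈⟨ FiniteField.*-identityʳ F _ ⟨
    ((t ⊗ w · u) ⊗ (t ⊗ w · u)) ⊗ 1#
      ≈⟨ ⊗-congˡ (⁻¹-inverse _ (⊗-≉0 ‖w‖≉0 ‖u‖≉0)) ⟨
    ((t ⊗ w · u) ⊗ (t ⊗ w · u)) ⊗ (n ⊗ n ⁻¹)
      ≈⟨ ring 5 (λ t x a b i → ((t :* x) :* (t :* x)) :* ((a :* b) :* i)
           := ((x :* x) :* i) :* (a :* (t :* (t :* b)))) ≈-refl t (w · u) ‖ w ‖ ‖ u ‖ (n ⁻¹) ⟩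
    ((w · u ⊗ w · u) ⊗ (n ⁻¹)) ⊗ (‖ w ‖ ⊗ (t ⊗ (t ⊗ ‖ u ‖)))
      ≈⟨ ⊗-congʳ (ring 2 (λ o z → z := o :- (o :- z)) ≈-refl 1# _) ⟩
    (1# ⊖ spread w u) ⊗ (‖ w ‖ ⊗ (t ⊗ (t ⊗ ‖ u ‖)))
      ≈⟨ ⊗-cong (⊖-cong ≈-refl spread≈s) (⊗-congˡ (≈-trans (≈-sym (‖∗‖ t u)) ‖tu‖≈g)) ⟩
    (1# ⊖ s) ⊗ (‖ w ‖ ⊗ g) ∎
    where
    open ≈-Reasoning
    n : Carrier
    n = ‖ w ‖ ⊗ ‖ u ‖

  -- Rescaling the directions to a common norm g, chosen by averaging, costs nothing in number.
  large-sphere : (D : List (Point d)) → Anisotropic D →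
                 ∃ λ g → length D ≤ length (filter (λ y → ‖ y ‖ ≟ g) (cone D))
  large-sphere D anisotropic with average-≤ nonzeros 0<nonzeros total
    where
    open ≤-Reasoning
    total : ∑ nonzeros (λ _ → length D) ≤ ∑ nonzeros (λ g → length (filter (λ y → ‖ y ‖ ≟ g) (cone D)))
    total = begin
      ∑ nonzeros (λ _ → length D)                            ≡⟨ trans (∑-const nonzeros _) (*-comm (length nonzeros) (length D)) ⟩
      length D * length nonzeros                             ≡⟨ ∑-const D _ ⟨
      ∑ D (λ _ → length nonzeros)                            ≡⟨ ∑-cong D (λ _ → ∑-1 nonzeros) ⟨
      ∑ D (λ _ → ∑ nonzeros (λ _ → 1))                       ≡⟨ ∑-cone D (λ _ → 1) ⟨
      ∑ (cone D) (λ _ → 1)                                   ≤⟨ ∑-mono-∈ (cone D) (λ y∈ → Any⇒1≤∑ (λ g → _ ≟ g) (nonzeros-complete (cone-anisotropic y∈))) ⟩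
      ∑ (cone D) (λ y → ∑ nonzeros (λ g → 𝟙 (‖ y ‖ ≟ g)))    ≡⟨ ∑-swap (cone D) nonzeros _ ⟩
      ∑ nonzeros (λ g → ∑ (cone D) (λ y → 𝟙 (‖ y ‖ ≟ g)))    ≡⟨ ∑-cong nonzeros (λ g → length-filter (λ y → ‖ y ‖ ≟ g) (cone D)) ⟨
      ∑ nonzeros (λ g → length (filter (λ y → ‖ y ‖ ≟ g) (cone D))) ∎
      where
      cone-anisotropic : Anisotropic (cone D)
      cone-anisotropic y∈ with ∈-cone⁻ {D = D} y∈
      ... | w , t , w∈ , t≉0 , refl = ⊗-≉0 t≉0 (⊗-≉0 t≉0 (anisotropic w∈)) ∘ ≈-trans (≈-sym (‖∗‖ t w))
  ... | g , _ , bound = g , bound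

  -- Each `s` in `T` allows at most two values of `w · y`, the square roots of `(1# ⊖ s) ⊗ a`. So at
  -- most `2 * length T` labels occur, and `collisions` applies.
  squared-labels : (Y : List (Point d)) (T : List Carrier) (w : Point d) (a : Carrier) →
                   (∀ {y} → y ∈ Y → Any (λ s → w · y ⊗ w · y ≈ (1# ⊖ s) ⊗ a) T) →
                   length Y * length Y ≤ (2 * length T) * energy Y w
  squared-labels Y T w a labelled = ≤-trans
    (collisions (λ y t → w · y ≟ t) (λ y z → w · y ≟ w · z) Y labels
      (λ y∈ → filter-complete labelled? (λ t≈t′ → Any.map (≈-trans (⊗-cong (≈-sym t≈t′) (≈-sym t≈t′)))) (labelled y∈))
      (λ y → ≤-trans (∑-filter-≤ labelled? elements _) (≤-reflexive (∑≟≡1 (w · y)))) (λ p r → ≈-trans p (≈-sym r)))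
    (*-monoˡ-≤ (energy Y w) labels≤)
    where
    open ≤-Reasoning
    label? : ∀ t s → Dec (t ⊗ t ≈ (1# ⊖ s) ⊗ a)
    label? t s = t ⊗ t ≟ (1# ⊖ s) ⊗ a
    labelled? : ∀ t → Dec (Any (λ s → t ⊗ t ≈ (1# ⊖ s) ⊗ a) T)
    labelled? t = Any.any? (label? t) T
    labels : List Carrier
    labels = filter labelled? elements
    labels≤ : length labels ≤ 2 * length T
    labels≤ = begin
      length labels                                    ≡⟨ length-filter labelled? elements ⟩
      ∑ elements (λ t → 𝟙 (labelled? t))               ≤⟨ ∑-mono elements (λ t → 𝟙≤ (labelled? t) (Any⇒1≤∑ (label? t))) ⟩
      ∑ elements (λ t → ∑ T (λ s → 𝟙 (label? t s)))    ≡⟨ ∑-swap elements T _ ⟩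
      ∑ T (λ s → ∑ elements (λ t → 𝟙 (label? t s)))    ≤⟨ ∑-mono T (λ s → quadratic-roots-≤2 (λ t → label? t s) 1# 0# (⊝ ((1# ⊖ s) ⊗ a)) 1≉0
                                                           (λ h → ≈-trans (⊕-congʳ (≈-trans (⊕-cong (⊗-identityˡ _) (⊗-zeroˡ _)) (FiniteField.+-identityʳ F _))) (≈⇒⊖≈0 h))) ⟩
      ∑ T (λ _ → 2)                                    ≡⟨ trans (∑-const T 2) (*-comm (length T) 2) ⟩
      2 * length T                                     ∎

  -- Here `n` counts directions, `y` the points of the sphere, `t` the labels, `e` is the energy and
  -- `s` is q^d. Since `n ≤ y`, the error y s / n is at most K² y², so `q * e` is at most (1 + K²)
  -- y²; this is compared with `y * y ≤ t * e`.
  energy-count : ∀ {q n y e t s} K → 0 < n → n ≤ y → s ≤ (K * n) * (K * n) →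
                 n * (q * e) ≤ n * (y * y) + y * s → y * y ≤ t * e → q ≤ (1 + K * K) * t
  energy-count {q} {n} {y} {e} {t} {s} K 0<n n≤y s≤ energy≤ squares≤ =
    *-cancelʳ-≤ q _ (n * (y * y)) {{>-nonZero (*-mono-≤ 0<n (*-mono-≤ (≤-trans 0<n n≤y) (≤-trans 0<n n≤y)))}} (begin
      q * (n * (y * y))                          ≤⟨ *-monoʳ-≤ q (*-monoʳ-≤ n squares≤) ⟩
      q * (n * (t * e))                          ≡⟨ exchange q n t e ⟩
      t * (n * (q * e))                          ≤⟨ *-monoʳ-≤ t energy≤ ⟩
      t * (n * (y * y) + y * s)                  ≤⟨ *-monoʳ-≤ t (+-monoʳ-≤ (n * (y * y)) error≤) ⟩
      t * (n * (y * y) + (K * K) * (n * (y * y))) ≡⟨ collect t (n * (y * y)) (K * K) ⟩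
      (1 + K * K) * t * (n * (y * y))            ∎)
    where
    open ≤-Reasoning
    exchange : ∀ q n l e → q * (n * (l * e)) ≡ l * (n * (q * e))
    exchange = solve-∀
    gather : ∀ y k n → y * ((k * n) * (k * n)) ≡ (k * k) * (n * (y * n))
    gather = solve-∀
    collect : ∀ t m k → t * (m + k * m) ≡ (1 + k) * t * m
    collect = solve-∀
    error≤ : y * s ≤ (K * K) * (n * (y * y))
    error≤ = begin
      y * s                    ≤⟨ *-monoʳ-≤ y s≤ ⟩
      y * ((K * n) * (K * n))  ≡⟨ gather y K n ⟩
      (K * K) * (n * (y * n))  ≤⟨ *-monoʳ-≤ (K * K) (*-monoʳ-≤ n (*-monoʳ-≤ y n≤y)) ⟩
      (K * K) * (n * (y * y))  ∎

  -- `excess-directions` bounds the excess summed over `D`, so some direction has at most the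
  -- average, |Y| q^d / |D|.
  good-pin : (D Y : List (Point d)) → Nonparallel D → Anisotropic D → Distinct Y → 0 < length D →
             ∃ λ w → w ∈ D × length D * (q * energy Y w) ≤ length D * (length Y * length Y) + length Y * q ^ d
  good-pin {d} D Y nonparallel anisotropic distY 0<D with average-≤ D 0<D total
    where
    open ≤-Reasoning
    total : ∑ D (λ w → length D * excess Y w) ≤ ∑ D (λ _ → length Y * q ^ d)
    total = begin
      ∑ D (λ w → length D * excess Y w)   ≡⟨ ∑-*ˡ D (length D) _ ⟩
      length D * ∑ D (excess Y)           ≤⟨ *-monoʳ-≤ (length D) (excess-directions D Y nonparallel anisotropic distY) ⟩
      length D * (length Y * q ^ d)       ≡⟨ ∑-const D _ ⟨
      ∑ D (λ _ → length Y * q ^ d)        ∎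
  ... | w , w∈ , bound = w , w∈ , (begin
    N * (q * energy Y w)             ≡⟨ cong (N *_) (q*energy≡ Y w) ⟨
    N * (excess Y w + y * y)         ≡⟨ *-distribˡ-+ N (excess Y w) (y * y) ⟩
    N * excess Y w + N * (y * y)     ≤⟨ +-monoˡ-≤ (N * (y * y)) bound ⟩
    y * q ^ d + N * (y * y)          ≡⟨ +-comm (y * q ^ d) (N * (y * y)) ⟩
    N * (y * y) + y * q ^ d          ∎)
    where
    open ≤-Reasoning
    N y : ℕ
    N = length D
    y = length Y

  -- The sphere `Y` is cut out of the lines spanned by `D`, so that every product of the pin `w`
  -- with a point of `Y` is tied to the spread of two members of `D`.
  direction-spreads : (D : List (Point d)) (T : List Carrier) (K : ℕ) →
                      Nonparallel D → Anisotropic D → 0 < length D → q ^ d ≤ (K * length D) * (K * length D) →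
                      (∀ {u v} → u ∈ D → v ∈ D → Any (spread u v ≈_) T) →
                      q ≤ (1 + K * K) * (2 * length T)
  direction-spreads {d} D T K nonparallel anisotropic 0<D large spreads∈T =
    let g , D≤sphere = large-sphere D anisotropic
        Y = filter (λ y → ‖ y ‖ ≟ g) (cone D)
        w , w∈ , energy≤ = good-pin D Y nonparallel anisotropic
                             (filter-Distinct (λ y → ‖ y ‖ ≟ g) {cone D} (cone-Distinct nonparallel anisotropic)) 0<D
    in energy-count K 0<D D≤sphere large energy≤ (squared-labels Y T w (‖ w ‖ ⊗ g) (labelled g w w∈))
    where
    labelled : ∀ g w → w ∈ D → ∀ {y} → y ∈ filter (λ y → ‖ y ‖ ≟ g) (cone D) →
               Any (λ s → w · y ⊗ w · y ≈ (1# ⊖ s) ⊗ (‖ w ‖ ⊗ g)) T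
    labelled g w w∈ y∈ with ∈-filter⁻ (λ y → ‖ y ‖ ≟ g) {xs = cone D} y∈
    ... | y∈cone , ‖y‖≈g with ∈-cone⁻ {D = D} y∈cone
    ...   | u , t , u∈ , _ , refl =
      Any.map (spread-∗ {w = w} {u} {t} (anisotropic w∈) (anisotropic u∈) ‖y‖≈g) (spreads∈T w∈ u∈)

  -- Linear maps that kill few given vectors

  0<q^ : ∀ k → 0 < q ^ k
  0<q^ k rewrite q≡1+nonzeros = m^n>0 (suc (length nonzeros)) k

  image : Vec (Point d) k → Point d → Point k
  image ms x = Vec.map (_· x) ms

  image-cong : (ms : Vec (Point d) k) {x y : Point d} → x ≋ y → image ms x ≋ image ms y
  image-cong [] h = []
  image-cong (m ∷ ms) h = ·-cong (≋-refl {u = m}) h ∷ image-cong ms h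

  image--ᵥ : (ms : Vec (Point d) k) (x y : Point d) → image ms (x -ᵥ y) ≋ image ms x -ᵥ image ms y
  image--ᵥ [] x y = []
  image--ᵥ (m ∷ ms) x y = ·--ᵥ m x y ∷ image--ᵥ ms x y

  image-∗-kernel : (ms : Vec (Point d) k) {t : Carrier} {x : Point d} → ¬ t ≈ 0# →
                   image ms (t ∗ x) ≋ 0ᵥ → image ms x ≋ 0ᵥ
  image-∗-kernel [] t≉0 [] = []
  image-∗-kernel (m ∷ ms) {t} {x} t≉0 (p ∷ ps) =
    ⊗-cancel-0 t≉0 (≈-trans (≈-sym (·-∗ t m x)) p) ∷ image-∗-kernel ms t≉0 ps

  -- By `hyperplane`, a nonzero vector is killed by at most a proportion 1/q of all functionals;
  -- some functional does no worse than the average.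
  rare-functional : (T : List (Point d)) → (∀ {v} → v ∈ T → ¬ v ≋ 0ᵥ) →
                    ∃ λ m → q * ∑ T (λ v → 𝟙 (m · v ≟ 0#)) ≤ length T
  rare-functional {d} T nonzero = let m , _ , bound = average-≤ (points d) nonempty total in m , bound
    where
    open ≤-Reasoning
    nonempty : 0 < length (points d)
    nonempty = subst (0 <_) (sym (length-points d)) (0<q^ d)
    total : ∑ (points d) (λ m → q * ∑ T (λ v → 𝟙 (m · v ≟ 0#))) ≤ ∑ (points d) (λ _ → length T)
    total = begin
      ∑ (points d) (λ m → q * ∑ T (λ v → 𝟙 (m · v ≟ 0#)))   ≡⟨ ∑-*ˡ (points d) q _ ⟩
      q * ∑ (points d) (λ m → ∑ T (λ v → 𝟙 (m · v ≟ 0#)))   ≡⟨ cong (q *_) (∑-swap (points d) T _) ⟩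
      q * ∑ T (λ v → ∑ (points d) (λ m → 𝟙 (m · v ≟ 0#)))   ≡⟨ ∑-*ˡ T q _ ⟨
      ∑ T (λ v → q * ∑ (points d) (λ m → 𝟙 (m · v ≟ 0#)))   ≤⟨ ∑-mono-∈ T (λ {v} v∈ → hyperplane v (nonzero v∈)) ⟩
      ∑ T (λ _ → q ^ d)                                     ≡⟨ trans (∑-const T _) (*-comm (length T) _) ⟩
      q ^ d * length T                                      ≡⟨ cong (_* length T) (length-points d) ⟨
      length (points d) * length T                          ≡⟨ ∑-const (points d) _ ⟨
      ∑ (points d) (λ _ → length T)                         ∎

  -- The rows are chosen one at a time, each for the vectors that the earlier rows have killed, and
  -- each divides their number by at least `q`.
  rare-kernel : ∀ k (T : List (Point d)) → (∀ {v} → v ∈ T → ¬ v ≋ 0ᵥ) →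
                ∃ λ (ms : Vec (Point d) k) → q ^ k * ∑ T (λ v → 𝟙 (image ms v ≋? 0ᵥ)) ≤ length T
  rare-kernel zero T nonzero = [] , (begin
    1 * ∑ T (λ v → 𝟙 (image [] v ≋? 0ᵥ))   ≡⟨ *-identityˡ _ ⟩
    ∑ T (λ v → 𝟙 (image [] v ≋? 0ᵥ))       ≤⟨ ∑-mono T (λ v → 𝟙≤ (image [] v ≋? 0ᵥ) (λ _ → ≤-refl)) ⟩
    ∑ T (λ _ → 1)                          ≡⟨ ∑-1 T ⟩
    length T                               ∎)
    where open ≤-Reasoning
  rare-kernel (suc k) T nonzero =
    let m , rare = rare-functional T nonzero
        T′ = filter (λ v → m · v ≟ 0#) T
        ms , bound = rare-kernel k T′ (λ v∈ → nonzero (proj₁ (∈-filter⁻ (λ v → m · v ≟ 0#) {xs = T} v∈)))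
    in m ∷ ms , (begin
      q * q ^ k * ∑ T (λ v → 𝟙 (image (m ∷ ms) v ≋? 0ᵥ))
        ≡⟨ *-assoc q (q ^ k) _ ⟩
      q * (q ^ k * ∑ T (λ v → 𝟙 (image (m ∷ ms) v ≋? 0ᵥ)))
        ≤⟨ *-monoʳ-≤ q (*-monoʳ-≤ (q ^ k) (∑-mono T (λ v → 𝟙≤ (image (m ∷ ms) v ≋? 0ᵥ)
             (λ { (p ∷ ps) → *-mono-≤ (1≤𝟙 (m · v ≟ 0#) p) (1≤𝟙 (image ms v ≋? 0ᵥ) ps) })))) ⟩
      q * (q ^ k * ∑ T (λ v → 𝟙 (m · v ≟ 0#) * 𝟙 (image ms v ≋? 0ᵥ)))
        ≡⟨ cong (λ n → q * (q ^ k * n)) (∑-filter (λ v → m · v ≟ 0#) T _) ⟨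
      q * (q ^ k * ∑ T′ (λ v → 𝟙 (image ms v ≋? 0ᵥ)))
        ≤⟨ *-monoʳ-≤ q bound ⟩
      q * length T′
        ≡⟨ cong (q *_) (length-filter (λ v → m · v ≟ 0#) T) ⟩
      q * ∑ T (λ v → 𝟙 (m · v ≟ 0#))
        ≤⟨ rare ⟩
      length T ∎)
    where open ≤-Reasoning

  -- Isotropic and anisotropic differences in a point set

  Separated : List (Point d) → Set _
  Separated = AllPairs (λ x y → ¬ x ≋ y)

  module PointSet {d : ℕ} (P : List (Point d)) (separated : Separated P) where
    isotropic? : (a x : Point d) → Dec (‖ x -ᵥ a ‖ ≈ 0#)
    isotropic? a x = ‖ x -ᵥ a ‖ ≟ 0#

    anisotropic? : (a x : Point d) → Dec (¬ ‖ x -ᵥ a ‖ ≈ 0#)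
    anisotropic? a x = ¬? (isotropic? a x)

    deg₀ deg₁ : Point d → ℕ
    deg₀ a = ∑ P (λ x → 𝟙 (isotropic? a x))
    deg₁ a = ∑ P (λ x → 𝟙 (anisotropic? a x))

    deg₀+deg₁ : ∀ a → deg₀ a + deg₁ a ≡ length P
    deg₀+deg₁ a = trans (sym (∑-+ P _ _)) (trans (∑-cong P (λ x → 𝟙+𝟙¬ (isotropic? a x))) (∑-1 P))

    differences-≤1 : ∀ a u → ∑ P (λ x → 𝟙 (x -ᵥ a ≋? u)) ≤ 1
    differences-≤1 a u = AllPairs⇒∑≤1 (λ x → x -ᵥ a ≋? u) separated
      (λ x≉y p r → x≉y (-ᵥ-injectiveˡ a (≋-trans p (≋-sym r))))

    dirs : Point d → List (Point d)
    dirs a = deduplicate _∥?_ (map (_-ᵥ a) (filter (anisotropic? a) P))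

    dirs-Nonparallel : ∀ a → Nonparallel (dirs a)
    dirs-Nonparallel a = deduplicate-AllPairs _∥?_ (map (_-ᵥ a) (filter (anisotropic? a) P))

    ∈-dirs⁻ : ∀ {a u} → u ∈ dirs a → ∃ λ x → x ∈ P × (¬ ‖ u ‖ ≈ 0#) × u ≡ x -ᵥ a
    ∈-dirs⁻ {a} u∈ with ∈-map⁻ (_-ᵥ a) (∈-deduplicate⁻ _∥?_ (map (_-ᵥ a) (filter (anisotropic? a) P)) u∈)
    ... | x , x∈ , refl = let x∈P , ‖x-a‖≉0 = ∈-filter⁻ (anisotropic? a) {xs = P} x∈ in x , x∈P , ‖x-a‖≉0 , refl

    dirs-Anisotropic : ∀ a → Anisotropic (dirs a)
    dirs-Anisotropic a u∈ = proj₁ (proj₂ (proj₂ (∈-dirs⁻ u∈)))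

    dirs-cover : ∀ {a x} → x ∈ P → ¬ ‖ x -ᵥ a ‖ ≈ 0# → Any (_∥ (x -ᵥ a)) (dirs a)
    dirs-cover {a} x∈ ‖x-a‖≉0 = Any.deduplicate⁺ _∥?_ (λ v∥u u∥ → ∥-trans v∥u u∥)
      (lose (∈-map⁺ (_-ᵥ a) (∈-filter⁺ (anisotropic? a) x∈ ‖x-a‖≉0)) ∥-refl)

    line : Point d → Point d → List (Point d)
    line a u = filter (λ c → u ∥? (c -ᵥ a)) P

    -- Along the line, the norm of the difference to `x` is a quadratic polynomial in the parameter,
    -- with leading coefficient `‖ u ‖`, which is nonzero.
    line-isotropic-≤2 : ∀ a u → ¬ ‖ u ‖ ≈ 0# → ∀ x → ∑ (line a u) (λ c → 𝟙 (isotropic? c x)) ≤ 2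
    line-isotropic-≤2 a u ‖u‖≉0 x = ≤-trans
      (∑-inject (λ c t → c -ᵥ a ≋? t ∗ u) (line a u) elements
        (λ c∈ → proj₂ (∈-filter⁻ (λ c → u ∥? (c -ᵥ a)) {xs = P} c∈))
        (λ t → ≤-trans (∑-filter-≤ (λ c → u ∥? (c -ᵥ a)) P _) (differences-≤1 a (t ∗ u)))
        (λ {c} {t} c-a≋tu → 𝟙-mono (isotropic? c x) (‖ (x -ᵥ a) -ᵥ t ∗ u ‖ ≟ 0#)
          (≈-trans (‖‖-cong (≋-trans (-ᵥ-cong ≋-refl (≋-sym c-a≋tu)) (-ᵥ-translate x c a))))))
      (quadratic-roots-≤2 (λ t → ‖ (x -ᵥ a) -ᵥ t ∗ u ‖ ≟ 0#) (‖ u ‖) (⊝ (v · u ⊕ v · u)) (‖ v ‖) ‖u‖≉0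
        (λ {t} → ≈-trans (expansion t)))
      where
      v : Point d
      v = x -ᵥ a
      expansion : ∀ t → ((‖ u ‖ ⊗ (t ⊗ t)) ⊕ (⊝ (v · u ⊕ v · u) ⊗ t)) ⊕ ‖ v ‖ ≈ ‖ v -ᵥ t ∗ u ‖
      expansion t = ≈-sym (begin
        ‖ v -ᵥ t ∗ u ‖
          ≈⟨ ‖-ᵥ‖ v (t ∗ u) ⟩
        (‖ v ‖ ⊖ (v · (t ∗ u) ⊕ v · (t ∗ u))) ⊕ ‖ t ∗ u ‖
          ≈⟨ ⊕-cong (⊖-cong ≈-refl (⊕-cong (·-∗ t v u) (·-∗ t v u))) (‖∗‖ t u) ⟩
        (‖ v ‖ ⊖ (t ⊗ v · u ⊕ t ⊗ v · u)) ⊕ t ⊗ (t ⊗ ‖ u ‖)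
          ≈⟨ ring 4 (λ n t b m → (n :- (t :* b :+ t :* b)) :+ t :* (t :* m)
                               := ((m :* (t :* t)) :+ ((:- (b :+ b)) :* t)) :+ n) ≈-refl (‖ v ‖) t (v · u) (‖ u ‖) ⟩
        ((‖ u ‖ ⊗ (t ⊗ t)) ⊕ (⊝ (v · u ⊕ v · u) ⊗ t)) ⊕ ‖ v ‖ ∎)
        where open ≈-Reasoning

    -- Points isotropic to a positive proportion of the set

    module Threshold (r : ℕ) where

      Heavy : Point d → Set
      Heavy a = length P ≤ r * deg₀ a

      heavy? : ∀ a → Dec (Heavy a)
      heavy? a = length P ≤? r * deg₀ a

      -- Double counting of isotropic pairs (c, x) with `c` on the line: a heavy `c` lies in at
      -- least |P|/r of them, an arbitrary `x` in at most two.
      line-heavy : 0 < length P → ∀ a u → ¬ ‖ u ‖ ≈ 0# → ∑ (line a u) (𝟙 ∘ heavy?) ≤ r * 2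
      line-heavy 0<P a u ‖u‖≉0 = *-cancelˡ-≤ (length P) {{>-nonZero 0<P}} (begin
        length P * ∑ (line a u) (𝟙 ∘ heavy?)
          ≡⟨ ∑-*ˡ (line a u) (length P) _ ⟨
        ∑ (line a u) (λ c → length P * 𝟙 (heavy? c))
          ≤⟨ ∑-mono (line a u) (λ c → ≤-trans (≤-reflexive (*-comm (length P) (𝟙 (heavy? c)))) (𝟙*≤ (heavy? c) (λ heavy → heavy))) ⟩
        ∑ (line a u) (λ c → r * deg₀ c)
          ≡⟨ trans (∑-*ˡ (line a u) r _) (cong (r *_) (∑-swap (line a u) P _)) ⟩
        r * ∑ P (λ x → ∑ (line a u) (λ c → 𝟙 (isotropic? c x)))
          ≤⟨ *-monoʳ-≤ r (∑-mono P (line-isotropic-≤2 a u ‖u‖≉0)) ⟩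
        r * ∑ P (λ _ → 2)
          ≡⟨ cong (r *_) (∑-const P 2) ⟩
        r * (length P * 2)
          ≡⟨ exchange r (length P) ⟩
        length P * (r * 2) ∎)
        where
        open ≤-Reasoning
        exchange : ∀ r n → r * (n * 2) ≡ n * (r * 2)
        exchange = solve-∀

      -- The points in question lie on the lines through `a` in the directions `dirs a`, and
      -- `line-heavy` bounds the heavy points on each.
      anisotropic-heavy : 0 < length P → ∀ a → ∑ P (λ c → 𝟙 (anisotropic? a c) * 𝟙 (heavy? c)) ≤ length (dirs a) * (r * 2)
      anisotropic-heavy 0<P a = begin
        ∑ P (λ c → 𝟙 (anisotropic? a c) * 𝟙 (heavy? c))
          ≤⟨ ∑-mono-∈ P (λ {c} c∈ → *-monoˡ-≤ (𝟙 (heavy? c)) (𝟙≤ (anisotropic? a c)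
               (λ aniso → Any⇒1≤∑ (_∥? (c -ᵥ a)) (dirs-cover c∈ aniso)))) ⟩
        ∑ P (λ c → ∑ (dirs a) (λ u → 𝟙 (u ∥? (c -ᵥ a))) * 𝟙 (heavy? c))
          ≡⟨ ∑-cong P (λ c → sym (∑-*ʳ (dirs a) (𝟙 (heavy? c)) _)) ⟩
        ∑ P (λ c → ∑ (dirs a) (λ u → 𝟙 (u ∥? (c -ᵥ a)) * 𝟙 (heavy? c)))
          ≡⟨ ∑-swap P (dirs a) _ ⟩
        ∑ (dirs a) (λ u → ∑ P (λ c → 𝟙 (u ∥? (c -ᵥ a)) * 𝟙 (heavy? c)))
          ≡⟨ ∑-cong (dirs a) (λ u → ∑-filter (λ c → u ∥? (c -ᵥ a)) P _) ⟨
        ∑ (dirs a) (λ u → ∑ (line a u) (𝟙 ∘ heavy?))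
          ≤⟨ ∑-mono-∈ (dirs a) (λ {u} u∈ → line-heavy 0<P a u (dirs-Anisotropic a u∈)) ⟩
        ∑ (dirs a) (λ _ → r * 2)
          ≡⟨ ∑-const (dirs a) _ ⟩
        length (dirs a) * (r * 2) ∎
        where open ≤-Reasoning

    -- Point sets with almost only isotropic differences

    isotropic-self : (a : Point d) → ‖ a -ᵥ a ‖ ≈ 0#
    isotropic-self a = ≈-trans (‖‖-cong (≋⇒-ᵥ≋0ᵥ (≋-refl {u = a}))) (·-0ᵥ {d} 0ᵥ)

    -- Polarisation: twice `x · y` is `‖ y ‖ ⊕ ‖ x ‖` minus `‖ y -ᵥ x ‖`, and 2 can be cancelled.
    isotropic-orthogonal : ¬ 1# ⊕ 1# ≈ 0# → (x y : Point d) → ‖ x ‖ ≈ 0# → ‖ y ‖ ≈ 0# → ‖ y -ᵥ x ‖ ≈ 0# → x · y ≈ 0#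
    isotropic-orthogonal 2≉0 x y x≈0 y≈0 y-x≈0 = ⊗-cancel-0 2≉0 (begin
      (1# ⊕ 1#) ⊗ x · y                      ≈⟨ FiniteField.distribʳ F (x · y) 1# 1# ⟩
      1# ⊗ x · y ⊕ 1# ⊗ x · y                ≈⟨ ⊕-cong (⊗-identityˡ _) (⊗-identityˡ _) ⟩
      x · y ⊕ x · y                          ≈⟨ ring 3 (λ b m n → b :+ b := (n :+ m) :- ((n :- (b :+ b)) :+ m)) ≈-refl (x · y) (‖ x ‖) (‖ y ‖) ⟩
      (‖ y ‖ ⊕ ‖ x ‖) ⊖ ((‖ y ‖ ⊖ (x · y ⊕ x · y)) ⊕ ‖ x ‖)
        ≈⟨ ⊖-cong (≈-trans (⊕-cong y≈0 x≈0) (⊕-identityˡ 0#))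
             (≈-trans (⊕-congʳ (⊖-cong ≈-refl (⊕-cong (·-comm x y) (·-comm x y)))) (≈-trans (≈-sym (‖-ᵥ‖ y x)) y-x≈0)) ⟩
      0# ⊖ 0#                                ≈⟨ ≈⇒⊖≈0 ≈-refl ⟩
      0#                                     ∎)
      where open ≈-Reasoning

    -- If almost all differences are isotropic, then the isotropic differences Y from one point are
    -- nearly orthogonal to each other, so that Y is a set of pins of large energy for itself.
    isotropic-bound : ¬ 1# ⊕ 1# ≈ 0# → ∀ κ → 0 < length P → (∀ {a} → a ∈ P → deg₁ a ≤ κ) →
                      ∃ λ y → length P ≤ y + κ ×
                              (y ∸ κ) * (y ∸ κ) * suc (length nonzeros) ≤ y * y + length nonzeros * q ^ d
    -- Averaging the zero function only picks some point of the nonempty `P`.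
    isotropic-bound 2≉0 κ 0<P deg₁≤ with average-≤ P {λ _ → 0} {λ _ → 0} 0<P ≤-refl
    ... | a , a∈ , _ = length Y , n≤ , bound
      where
      open ≤-Reasoning
      I Y : List (Point d)
      I = filter (isotropic? a) P
      Y = map (_-ᵥ a) I
      |Y| : length Y ≡ deg₀ a
      |Y| = trans (length-map (_-ᵥ a) I) (length-filter (isotropic? a) P)
      distinct : Distinct Y
      distinct u = begin
        ∑ Y (λ y → 𝟙 (y ≋? u))            ≡⟨ ∑-map (_-ᵥ a) I _ ⟩
        ∑ I (λ x → 𝟙 (x -ᵥ a ≋? u))       ≤⟨ ∑-filter-≤ (isotropic? a) P _ ⟩
        ∑ P (λ x → 𝟙 (x -ᵥ a ≋? u))       ≤⟨ differences-≤1 a u ⟩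
        1                                 ∎
      n≤ : length P ≤ length Y + κ
      n≤ = begin
        length P          ≡⟨ deg₀+deg₁ a ⟨
        deg₀ a + deg₁ a   ≤⟨ +-mono-≤ (≤-reflexive (sym |Y|)) (deg₁≤ a∈) ⟩
        length Y + κ      ∎
      0<Y : 0 < length Y
      0<Y = subst (0 <_) (sym |Y|) (Any⇒1≤∑ (isotropic? a) (lose a∈ (isotropic-self a)))
      pin : ∃ λ x → x ∈ Y × excess Y x ≤ length nonzeros * q ^ d
      pin = average-≤ Y 0<Y (≤-trans (excess-Distinct Y Y distinct distinct) (≤-reflexive (sym (∑-const Y _))))
      bound : (length Y ∸ κ) * (length Y ∸ κ) * suc (length nonzeros) ≤ length Y * length Y + length nonzeros * q ^ d
      bound with pin
      ... | x , x∈ , excess≤ with ∈-map⁻ (_-ᵥ a) x∈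
      ...   | p , p∈ , refl = begin
        (length Y ∸ κ) * (length Y ∸ κ) * suc (length nonzeros)
          ≤⟨ *-monoˡ-≤ (suc (length nonzeros)) (≤-trans (*-mono-≤ y∸κ≤z y∸κ≤z) z²≤energy) ⟩
        energy Y x * suc (length nonzeros)
          ≡⟨ trans (*-comm (energy Y x) _) (cong (_* energy Y x) (sym q≡1+nonzeros)) ⟩
        q * energy Y x
          ≡⟨ q*energy≡ Y x ⟨
        excess Y x + length Y * length Y
          ≤⟨ +-monoˡ-≤ (length Y * length Y) excess≤ ⟩
        length nonzeros * q ^ d + length Y * length Y
          ≡⟨ +-comm (length nonzeros * q ^ d) _ ⟩
        length Y * length Y + length nonzeros * q ^ d ∎
        where
        p∈P : p ∈ P
        p∈P = proj₁ (∈-filter⁻ (isotropic? a) {xs = P} p∈)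
        ‖x‖≈0 : ‖ x ‖ ≈ 0#
        ‖x‖≈0 = proj₂ (∈-filter⁻ (isotropic? a) {xs = P} p∈)
        z : ℕ
        z = ∑ Y (λ y → 𝟙 (x · y ≟ 0#))
        -- Any two vectors orthogonal to `x` collide, at the value 0.
        z²≤energy : z * z ≤ energy Y x
        z²≤energy = begin
          z * z                                                       ≡⟨ ∑-*ʳ Y z _ ⟨
          ∑ Y (λ y → 𝟙 (x · y ≟ 0#) * z)                              ≡⟨ ∑-cong Y (λ y → sym (∑-*ˡ Y (𝟙 (x · y ≟ 0#)) _)) ⟩
          ∑ Y (λ y → ∑ Y (λ y′ → 𝟙 (x · y ≟ 0#) * 𝟙 (x · y′ ≟ 0#)))   ≤⟨ ∑-mono Y (λ y → ∑-mono Y (λ y′ →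
            𝟙*≤ (x · y ≟ 0#) (λ xy≈0 → 𝟙-mono (x · y′ ≟ 0#) (x · y ≟ x · y′) (λ xy′≈0 → ≈-trans xy≈0 (≈-sym xy′≈0))))) ⟩
          energy Y x                                                  ∎
        -- Both `x = p -ᵥ a` and `c -ᵥ a` are isotropic, so only an anisotropic `c -ᵥ p` can prevent
        -- orthogonality. By `deg₁≤` at `p`, this happens for at most `κ` points.
        orthogonal-or-anisotropic : ∀ {c} → c ∈ I → 1 ≤ 𝟙 (x · (c -ᵥ a) ≟ 0#) + 𝟙 (anisotropic? p c)
        orthogonal-or-anisotropic {c} c∈ with isotropic? p c
        ... | no ‖c-p‖≉0 = m≤n+m 1 _
        ... | yes ‖c-p‖≈0 = ≤-trans (1≤𝟙 (x · (c -ᵥ a) ≟ 0#) (isotropic-orthogonal 2≉0 x (c -ᵥ a) ‖x‖≈0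
            (proj₂ (∈-filter⁻ (isotropic? a) {xs = P} c∈)) (≈-trans (‖‖-cong (-ᵥ-translate c p a)) ‖c-p‖≈0)))
          (m≤m+n _ _)
        y∸κ≤z : length Y ∸ κ ≤ z
        y∸κ≤z = m≤n+o⇒m∸n≤o (length Y) κ (begin
          length Y
            ≡⟨ trans (length-map (_-ᵥ a) I) (sym (∑-1 I)) ⟩
          ∑ I (λ _ → 1)
            ≤⟨ ∑-mono-∈ I orthogonal-or-anisotropic ⟩
          ∑ I (λ c → 𝟙 (x · (c -ᵥ a) ≟ 0#) + 𝟙 (anisotropic? p c))
            ≡⟨ ∑-+ I _ _ ⟩
          ∑ I (λ c → 𝟙 (x · (c -ᵥ a) ≟ 0#)) + ∑ I (λ c → 𝟙 (anisotropic? p c))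
            ≤⟨ +-mono-≤ (≤-reflexive (sym (∑-map (_-ᵥ a) I _))) (≤-trans (∑-filter-≤ (isotropic? a) P _) (deg₁≤ p∈P)) ⟩
          z + κ  ≡⟨ +-comm z κ ⟩
          κ + z ∎)

    -- Nearly injective projections

    neighbours : Point d → List (Point d)
    neighbours a = filter (λ x → isotropic? a x ×-dec ¬? (x ≋? a)) P

    -- A linear map that kills none of these separates `a` from all other points of `P`. An
    -- anisotropic direction needs one vector for all the points on its line; isotropic differences
    -- are listed singly.
    obstructions : Point d → List (Point d)
    obstructions a = dirs a ++ map (_-ᵥ a) (neighbours a)

    length-obstructions : ∀ a → length (obstructions a) ≤ length (dirs a) + deg₀ a
    length-obstructions a = begin
      length (obstructions a)
        ≡⟨ trans (length-++ (dirs a)) (cong (length (dirs a) +_) (trans (length-map (_-ᵥ a) (neighbours a)) (length-filter (λ x → isotropic? a x ×-dec ¬? (x ≋? a)) P))) ⟩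
      length (dirs a) + ∑ P (λ x → 𝟙 (isotropic? a x ×-dec ¬? (x ≋? a)))
        ≤⟨ +-monoʳ-≤ (length (dirs a)) (∑-mono P (λ x → 𝟙-mono _ (isotropic? a x) proj₁)) ⟩
      length (dirs a) + deg₀ a ∎
      where open ≤-Reasoning

    obstructions-≉0 : ∀ {a v} → v ∈ obstructions a → ¬ v ≋ 0ᵥ
    obstructions-≉0 {a} v∈ with ∈-++⁻ (dirs a) v∈
    ... | inj₁ v∈dirs = anisotropic⇒≉0ᵥ (dirs-Anisotropic a v∈dirs)
    ... | inj₂ v∈map with ∈-map⁻ (_-ᵥ a) v∈map
    ...   | x , x∈ , refl = λ x-a≋0 → proj₂ (proj₂ (∈-filter⁻ (λ x → isotropic? a x ×-dec ¬? (x ≋? a)) {xs = P} x∈)) (-ᵥ≋0ᵥ⇒≋ x-a≋0)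

    -- The killed difference is itself listed, or is a multiple of a listed direction by a factor
    -- that is nonzero because the difference is anisotropic.
    obstructed : ∀ {k} (ms : Vec (Point d) k) {a b : Point d} → b ∈ P → ¬ b ≋ a → image ms (b -ᵥ a) ≋ 0ᵥ →
                 Any (λ v → image ms v ≋ 0ᵥ) (obstructions a)
    obstructed ms {a} {b} b∈ b≉a killed with isotropic? a b
    ... | yes isotropic = lose (∈-++⁺ʳ (dirs a) (∈-map⁺ (_-ᵥ a)
            (∈-filter⁺ (λ x → isotropic? a x ×-dec ¬? (x ≋? a)) b∈ (isotropic , b≉a)))) killed
    ... | no anisotropic = Any.++⁺ˡ (Any.map kill (dirs-cover b∈ anisotropic))
      where
      kill : ∀ {u} → u ∥ (b -ᵥ a) → image ms u ≋ 0ᵥ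
      kill {u} u∥b-a with ∥-elim u∥b-a
      ... | t , b-a≋tu = image-∗-kernel ms t≉0 (≋-trans (image-cong ms (≋-sym b-a≋tu)) killed)
        where
        t≉0 : ¬ t ≈ 0#
        t≉0 t≈0 = anisotropic (≈-trans (‖‖-cong b-a≋tu) (≈-trans (‖∗‖ t u) (≈-trans (⊗-congʳ t≈0) (⊗-zeroˡ _))))

    -- A projection to a space of q ^ k points is injective on the points that it does not confuse with others,
    -- and a suitable projection confuses few points.
    projection-bound : ∀ k (X : List (Point d)) → Separated X → (∀ {x} → x ∈ X → x ∈ P) →
                       q ^ k * length X ≤ ∑ X (λ a → length (dirs a) + deg₀ a) + q ^ k * q ^ k
    projection-bound k X separatedX X⊆P
      -- A single map is chosen for the obstructions of all points of `X` together.
      with rare-kernel k (concatMap obstructions X)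
             (λ v∈ → let _ , _ , v∈a = find (∈-concatMap⁻ obstructions {xs = X} v∈) in obstructions-≉0 v∈a)
    ... | ms , rare = begin
      q ^ k * length X
        ≡⟨ cong (q ^ k *_) (∑-1 X) ⟨
      q ^ k * ∑ X (λ _ → 1)
        ≤⟨ *-monoʳ-≤ (q ^ k) (∑-mono X confused-or-not) ⟩
      q ^ k * ∑ X (λ a → ∑ (obstructions a) (𝟙 ∘ killed?) + 𝟙 (¬? (confused? a)))
        ≡⟨ trans (cong (q ^ k *_) (∑-+ X _ _)) (*-distribˡ-+ (q ^ k) _ _) ⟩
      q ^ k * ∑ X (λ a → ∑ (obstructions a) (𝟙 ∘ killed?)) + q ^ k * ∑ X (λ a → 𝟙 (¬? (confused? a)))
        ≤⟨ +-mono-≤ confused-bound (*-monoʳ-≤ (q ^ k) injective-bound) ⟩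
      ∑ X (λ a → length (dirs a) + deg₀ a) + q ^ k * q ^ k ∎
      where
      open ≤-Reasoning
      killed? : ∀ v → Dec (image ms v ≋ 0ᵥ)
      killed? v = image ms v ≋? 0ᵥ
      confused? : ∀ a → Dec (Any (λ v → image ms v ≋ 0ᵥ) (obstructions a))
      confused? a = Any.any? killed? (obstructions a)
      confused-or-not : ∀ a → 1 ≤ ∑ (obstructions a) (𝟙 ∘ killed?) + 𝟙 (¬? (confused? a))
      confused-or-not a with confused? a
      ... | yes confused = ≤-trans (Any⇒1≤∑ killed? confused) (m≤m+n _ _)
      ... | no _ = m≤n+m 1 _
      confused-bound : q ^ k * ∑ X (λ a → ∑ (obstructions a) (𝟙 ∘ killed?)) ≤ ∑ X (λ a → length (dirs a) + deg₀ a)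
      confused-bound = begin
        q ^ k * ∑ X (λ a → ∑ (obstructions a) (𝟙 ∘ killed?))   ≡⟨ cong (q ^ k *_) (∑-concatMap obstructions X _) ⟨
        q ^ k * ∑ (concatMap obstructions X) (𝟙 ∘ killed?)     ≤⟨ rare ⟩
        length (concatMap obstructions X)                      ≡⟨ trans (sym (∑-1 (concatMap obstructions X))) (∑-concatMap obstructions X _) ⟩
        ∑ X (λ a → ∑ (obstructions a) (λ _ → 1))               ≤⟨ ∑-mono X (λ a → ≤-trans (≤-reflexive (∑-1 (obstructions a))) (length-obstructions a)) ⟩
        ∑ X (λ a → length (dirs a) + deg₀ a)                   ∎
      clear : List (Point d)
      clear = filter (λ a → ¬? (confused? a)) X
      clear-separated : ∀ {a b} → a ∈ clear → b ∈ clear → ¬ a ≋ b → ∀ {p} → image ms a ≋ p → image ms b ≋ p → ⊥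
      clear-separated {a} {b} a∈ b∈ a≉b a↦p b↦p =
        proj₂ (∈-filter⁻ (λ a → ¬? (confused? a)) {xs = X} a∈)
          (obstructed ms (X⊆P (proj₁ (∈-filter⁻ (λ a → ¬? (confused? a)) {xs = X} b∈))) (a≉b ∘ ≋-sym)
            (≋-trans (image--ᵥ ms b a) (≋⇒-ᵥ≋0ᵥ (≋-trans b↦p (≋-sym a↦p)))))
      -- Points with no killed obstruction have pairwise different images, in a space of `q ^ k`
      -- points.
      injective-bound : ∑ X (λ a → 𝟙 (¬? (confused? a))) ≤ q ^ k
      injective-bound = begin
        ∑ X (λ a → 𝟙 (¬? (confused? a)))   ≡⟨ trans (sym (length-filter (λ a → ¬? (confused? a)) X)) (sym (∑-1 clear)) ⟩
        ∑ clear (λ _ → 1)                  ≤⟨ ∑-inject (λ a p → image ms a ≋? p) clear (points k) (λ _ → points-complete _)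
                                                (λ p → AllPairs⇒∑≤1-∈ (λ a → image ms a ≋? p) (AllPairs.filter⁺ _ separatedX)
                                                  (λ a∈ b∈ a≉b → clear-separated a∈ b∈ a≉b)) (λ _ → ≤-refl) ⟩
        ∑ (points k) (λ _ → 1)             ≡⟨ trans (∑-1 (points k)) (length-points k) ⟩
        q ^ k                              ∎

    -- Existence of a point that sees many directions

    module Pinning (2≉0 : ¬ 1# ⊕ 1# ≈ 0#) (m k : ℕ) (0<m : 0 < m) (q^d : q ^ d ≡ q ^ k * q ^ k)
             (large : suc m * q ^ k ≤ m * length P) (small : length P ≤ 2 * q ^ k) where
      open ≤-Reasoning

      -- The factor 12 serves twice: it exceeds the 8 lost in `few-directions-arithmetic`, and
      -- `κ * r ≤ 2 * Q` then becomes `6 * (m * κ) ≤ Q`.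
      r Q : ℕ
      r = 12 * m
      Q = q ^ k

      open Threshold r

      0<P : 0 < length P
      0<P = *-cancelˡ-< m 0 (length P) (begin-strict
        m * 0            ≡⟨ *-zeroʳ m ⟩
        0                <⟨ 0<q^ k ⟩
        Q                ≤⟨ m≤m+n Q (m * Q) ⟩
        suc m * Q        ≤⟨ large ⟩
        m * length P     ∎)

      module _ (few : ∀ {a} → a ∈ P → r * suc r * length (dirs a) ≤ Q) where

        -- If all points are heavy, `anisotropic-heavy` bounds all anisotropic differences at a
        -- point, so almost all of `P` is isotropic to it. This contradicts `isotropic-bound`.
        not-all-heavy : (∀ {a} → a ∈ P → Heavy a) → ⊥
        not-all-heavy heavy = let y , n≤ , bound = isotropic-bound 2≉0 κ 0<P deg₁≤κ in
          clique-arithmetic {m} (0<q^ k) 0<nonzeros 6mκ≤Q large n≤ (subst (λ s → (y ∸ κ) * (y ∸ κ) * suc (length nonzeros) ≤ y * y + length nonzeros * s) q^d bound)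
          where
          -- A point has at most 2r anisotropic differences per direction, and `few` allows Q / (r(r
          -- + 1)) directions.
          κ : ℕ
          κ = 2 * Q / suc r
          regroup : ∀ D r → D * (r * 2) * suc r ≡ 2 * (r * suc r * D)
          regroup = solve-∀
          twice : ∀ m κ → 2 * (6 * (m * κ)) ≡ κ * (12 * m)
          twice = solve-∀
          6mκ≤Q : 6 * (m * κ) ≤ Q
          6mκ≤Q = *-cancelˡ-≤ 2 (begin
            2 * (6 * (m * κ))   ≡⟨ twice m κ ⟩
            κ * r               ≤⟨ *-monoʳ-≤ κ (n≤1+n r) ⟩
            κ * suc r           ≤⟨ m/n*n≤m (2 * Q) (suc r) ⟩
            2 * Q               ∎)
          deg₁≤κ : ∀ {a} → a ∈ P → deg₁ a ≤ κ
          deg₁≤κ {a} a∈ = begin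
            deg₁ a                   ≡⟨ m*n/n≡m (deg₁ a) (suc r) ⟨
            deg₁ a * suc r / suc r   ≤⟨ /-monoˡ-≤ (suc r) (begin
              deg₁ a * suc r
                ≤⟨ *-monoˡ-≤ (suc r) (∑-mono-∈ P (λ {c} c∈ → ≤-reflexive (sym (trans (cong (𝟙 (anisotropic? a c) *_) (𝟙-yes (heavy? c) (heavy c∈))) (*-identityʳ _))))) ⟩
              ∑ P (λ c → 𝟙 (anisotropic? a c) * 𝟙 (heavy? c)) * suc r
                ≤⟨ *-monoˡ-≤ (suc r) (anisotropic-heavy 0<P a) ⟩
              length (dirs a) * (r * 2) * suc r
                ≡⟨ regroup (length (dirs a)) r ⟩
              2 * (r * suc r * length (dirs a))
                ≤⟨ *-monoʳ-≤ 2 (few a∈) ⟩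
              2 * Q ∎) ⟩
            2 * Q / suc r            ∎

        -- Seen from a light point, heavy points are rare: few are isotropic to it, and the others
        -- lie on few lines. So most points are light, each with few obstructions, and
        -- `projection-bound` limits their number.
        no-light : ∀ {a} → a ∈ P → ¬ Heavy a → ⊥
        no-light {a} a∈ light = few-directions-arithmetic {m} {r} {length P} {length H} {∑ P (𝟙 ∘ heavy?)} {length (dirs a)} {deg₀ a} {T} {Q}
          refl 0<m (0<q^ k) small large partition heavy-count (<⇒≤ (≰⇒> light)) (few a∈)
          (projection-bound k H (AllPairs.filter⁺ _ separated) (λ b∈ → proj₁ (∈-filter⁻ (λ b → ¬? (heavy? b)) {xs = P} b∈))) T≤
          where
          H : List (Point d)
          H = filter (λ b → ¬? (heavy? b)) P
          T : ℕ
          T = ∑ H (λ b → length (dirs b) + deg₀ b)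
          partition : length H + ∑ P (𝟙 ∘ heavy?) ≡ length P
          partition = trans (+-comm (length H) _) (trans (cong (∑ P (𝟙 ∘ heavy?) +_) (length-filter (λ b → ¬? (heavy? b)) P))
            (trans (sym (∑-+ P _ _)) (trans (∑-cong P (λ b → 𝟙+𝟙¬ (heavy? b))) (∑-1 P))))
          split : ∀ c → 𝟙 (heavy? c) ≤ 𝟙 (isotropic? a c) + 𝟙 (anisotropic? a c) * 𝟙 (heavy? c)
          split c with isotropic? a c
          ... | yes _ = ≤-trans (𝟙≤ (heavy? c) (λ _ → ≤-refl)) (m≤m+n 1 _)
          ... | no _ = ≤-reflexive (sym (*-identityˡ _))
          heavy-count : ∑ P (𝟙 ∘ heavy?) ≤ deg₀ a + length (dirs a) * (r * 2)
          heavy-count = begin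
            ∑ P (𝟙 ∘ heavy?)                                             ≤⟨ ∑-mono P split ⟩
            ∑ P (λ c → 𝟙 (isotropic? a c) + 𝟙 (anisotropic? a c) * 𝟙 (heavy? c)) ≡⟨ ∑-+ P _ _ ⟩
            deg₀ a + ∑ P (λ c → 𝟙 (anisotropic? a c) * 𝟙 (heavy? c))     ≤⟨ +-monoʳ-≤ (deg₀ a) (anisotropic-heavy 0<P a) ⟩
            deg₀ a + length (dirs a) * (r * 2)                         ∎
          distribute : ∀ r D g → r * suc r * r * (D + g) ≡ r * (r * suc r * D) + r * suc r * (r * g)
          distribute = solve-∀
          T≤ : r * suc r * r * T ≤ length H * (r * Q + r * suc r * length P)
          T≤ = begin
            r * suc r * r * T
              ≡⟨ ∑-*ˡ H (r * suc r * r) _ ⟨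
            ∑ H (λ b → r * suc r * r * (length (dirs b) + deg₀ b))
              ≤⟨ ∑-mono-∈ H (λ {b} b∈ → let b∈P , lightb = ∈-filter⁻ (λ b → ¬? (heavy? b)) {xs = P} b∈ in
                   ≤-trans (≤-reflexive (distribute r (length (dirs b)) (deg₀ b)))
                           (+-mono-≤ (*-monoʳ-≤ r (few b∈P)) (*-monoʳ-≤ (r * suc r) (<⇒≤ (≰⇒> lightb))))) ⟩
            ∑ H (λ _ → r * Q + r * suc r * length P)
              ≡⟨ ∑-const H _ ⟩
            length H * (r * Q + r * suc r * length P) ∎

      -- If every point sees too few directions, either some point is light or all are heavy, and
      -- both cases are refuted.
      many-directions : ∃ λ a → a ∈ P × Q ≤ r * suc r * length (dirs a)
      many-directions with Any.any? (λ a → Q ≤? r * suc r * length (dirs a)) P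
      ... | yes some = find some
      ... | no none with Any.any? (λ a → ¬? (heavy? a)) P
      ...   | yes some = let _ , a∈ , light = find some in ⊥-elim (no-light (λ b∈ → <⇒≤ (≰⇒> (none ∘ lose b∈))) a∈ light)
      ...   | no none-light = ⊥-elim (not-all-heavy (λ b∈ → <⇒≤ (≰⇒> (none ∘ lose b∈)))
                                             (λ {a} a∈ → decidable-stable (heavy? a) (none-light ∘ lose a∈)))

  -- From directions to the number of spreads

  open Geometry F using (spreadList; card; numSpreads)

  -- Recovers the local function that lists the spread of a triple, if it is defined.
  entry : ∀ {d} (P : List (Point d)) →
          ∃ λ (f : Point d → Point d → Point d → List Carrier) → spreadList P ≡ concatMap (λ a → concatMap (λ b → concatMap (f a b) P) P) P
  entry P = _ , refl

  spread∈entry : ∀ {d} (P : List (Point d)) {a b c} → ¬ ‖ b -ᵥ a ‖ ≈ 0# → ¬ ‖ c -ᵥ a ‖ ≈ 0# →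
                 spread (b -ᵥ a) (c -ᵥ a) ∈ proj₁ (entry P) a b c
  spread∈entry P {a} {b} {c} b≉0 c≉0 with ‖ b -ᵥ a ‖ ≟ 0# | ‖ c -ᵥ a ‖ ≟ 0#
  ... | no _ | no _ = here refl
  ... | yes b≈0 | _ = ⊥-elim (b≉0 b≈0)
  ... | no _ | yes c≈0 = ⊥-elim (c≉0 c≈0)

  spread∈spreadList : ∀ {d} {P : List (Point d)} {a b c} → a ∈ P → b ∈ P → c ∈ P →
                      ¬ ‖ b -ᵥ a ‖ ≈ 0# → ¬ ‖ c -ᵥ a ‖ ≈ 0# → spread (b -ᵥ a) (c -ᵥ a) ∈ spreadList P
  spread∈spreadList {P = P} {a} {b} {c} a∈ b∈ c∈ b≉0 c≉0 =
    Any.concatMap⁺ _ (lose a∈ (Any.concatMap⁺ _ (lose b∈ (Any.concatMap⁺ _ (lose c∈ (spread∈entry P {a} {b} {c} b≉0 c≉0))))))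

  numSpreads-bound : ∀ m k (P : List (Point (k * 2))) → ¬ 2 ∣ q → 0 < m → suc m * q ^ k ≤ m * card P →
                     q ≤ suc (spreadConstant m) * numSpreads P
  numSpreads-bound m k P odd 0<m large =
    ≤-trans (pinned pin) (≤-reflexive (sym (*-assoc (1 + K * K) 2 (numSpreads P))))
    where
    Q K : ℕ
    Q = q ^ k
    K = 12 * m * suc (12 * m)
    q^d : q ^ (k * 2) ≡ q ^ k * q ^ k
    q^d = trans (cong (q ^_) (trans (*-comm k 2) (cong (λ j → k + j) (+-identityʳ k)))) (^-distribˡ-+-* q k k)
    -- Spreads of a sublist are spreads of `P`, so `P` may be cut down to the at most `2 * Q` points
    -- that `Pinning` admits. As `1 ≤ m`, `2 * Q` points still satisfy the lower bound.
    P′ : List (Point (k * 2))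
    P′ = take (2 * Q) (deduplicate _≋?_ P)
    separated : Separated P′
    separated = AllPairs.take⁺ (2 * Q) (deduplicate-AllPairs _≋?_ P)
    P′⊆P : ∀ {x} → x ∈ P′ → x ∈ P
    P′⊆P x∈ = ∈-deduplicate⁻ _≋?_ P (∈-take⁻ (2 * Q) x∈)
    length-P′ : length P′ ≡ 2 * Q ⊓ card P
    length-P′ = length-take (2 * Q) (deduplicate _≋?_ P)
    large′ : suc m * Q ≤ m * length P′
    large′ rewrite length-P′ with ≤-total (2 * Q) (card P)
    ... | inj₂ card≤ rewrite m≥n⇒m⊓n≡n card≤ = large
    ... | inj₁ ≤card rewrite m≤n⇒m⊓n≡m ≤card = begin
      Q + m * Q        ≤⟨ +-monoˡ-≤ (m * Q) (≤-trans (≤-reflexive (sym (*-identityˡ Q))) (*-monoˡ-≤ Q 0<m)) ⟩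
      m * Q + m * Q    ≡⟨ double m Q ⟩
      m * (2 * Q)      ∎
      where
      open ≤-Reasoning
      double : ∀ m Q → m * Q + m * Q ≡ m * (2 * Q)
      double = solve-∀
    open PointSet P′ separated
    pin : ∃ λ a → a ∈ P′ × Q ≤ K * length (dirs a)
    pin = Pinning.many-directions (odd⇒2≉0 odd) m k 0<m q^d large′ (≤-trans (≤-reflexive length-P′) (m⊓n≤m (2 * Q) (card P)))
    spreads : ∀ {a u v} → a ∈ P′ → u ∈ dirs a → v ∈ dirs a → Any (spread u v ≈_) (deduplicate _≟_ (spreadList P))
    spreads a∈ u∈ v∈ with ∈-dirs⁻ u∈ | ∈-dirs⁻ v∈
    ... | x , x∈ , ‖u‖≉0 , refl | y , y∈ , ‖v‖≉0 , refl = Any.deduplicate⁺ _≟_ (λ r p → ≈-trans p (≈-sym r))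
      (lose (spread∈spreadList (P′⊆P a∈) (P′⊆P x∈) (P′⊆P y∈) ‖u‖≉0 ‖v‖≉0) ≈-refl)
    pinned : (∃ λ a → a ∈ P′ × Q ≤ K * length (dirs a)) → q ≤ (1 + K * K) * (2 * numSpreads P)
    pinned (a , a∈ , many) =
      direction-spreads (dirs a) (deduplicate _≟_ (spreadList P)) K (dirs-Nonparallel a) (dirs-Anisotropic a)
        -- There is at least one direction, because `0 < Q ≤ K * length (dirs a)`.
        (*-cancelˡ-< K 0 _ (≤-trans (s≤s (≤-reflexive (*-zeroʳ K))) (≤-trans (0<q^ k) many)))
        (≤-trans (≤-reflexive q^d) (*-mono-≤ many many)) (spreads a∈)

-- The theorem with rational constants

open import Level using (0ℓ)
open import Data.Nat using (ℕ; suc; _^_; _/_) renaming (_≤_ to _≤ℕ_)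
open import Data.Nat.Primality using (Prime)
open import Data.Nat.Divisibility using (_∣_)
open import Data.Integer using (+_)
open import Data.Rational using (ℚ; 0ℚ; 1ℚ; _+_; _*_; _≤_; _<_) renaming (_/_ to _÷_)
open import Data.List using (List)
open import Data.Product using (Σ; _×_)
open import Relation.Binary.PropositionalEquality using (_≡_)
open import Relation.Nullary using (¬_)
open import Data.Nat.Divisibility using (divides)
open import Data.Nat.DivMod using (m*n/n≡m)
open import Data.Product using (_,_)
open import Relation.Binary.PropositionalEquality using (refl; subst)

theorem1p4 : (d : ℕ) → 2 ≤ℕ d → 2 ∣ d →
    (ε : ℚ) → 0ℚ < ε →
    Σ ℚ λ c → (0ℚ < c) ×
    ((q p k : ℕ) → Prime p → q ≡ p ^ suc k → ¬ (2 ∣ q) →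
    (F : FiniteField 0ℓ 0ℓ q) → (P : List (Geometry.Point F d)) →
    ((1ℚ + ε) * ((+ (q ^ (d / 2))) ÷ 1)) ≤ ((+ (Geometry.card F P)) ÷ 1) →
    (c * ((+ q) ÷ 1)) ≤ ((+ (Geometry.numSpreads F P)) ÷ 1))
theorem1p4 _ _ (divides k refl) ε 0<ε =
  let m , 0<m , clear = Rationals.clear-denominators ε 0<ε
      C = Arithmetic.spreadConstant m
  in (+ 1) ÷ suc C , Rationals.reciprocal-positive C , λ q _ _ _ _ odd F P large →
     Rationals.divide-≤ C q (Geometry.numSpreads F P) (FiniteGeometry.numSpreads-bound F m k P odd 0<m
       -- Evenness has been matched as `d = k * 2`, so the exponent `d / 2` has to be rewritten to
       -- `k`.
       (clear (q ^ k) (Geometry.card F P)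
         (subst (λ j → (1ℚ + ε) * ((+ (q ^ j)) ÷ 1) ≤ (+ (Geometry.card F P)) ÷ 1) (m*n/n≡m k 2) large)))
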